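{- There is an absolute constant $C>0$ such that for every integer $k\ge 3$ and every unweighted multigraph $G$ on $n\ge k$ vertices, the number of medium cuts of $G$ is at most $k^{Ck}\,n$.
   Context: $G=(V,E)$ is a finite unweighted multigraph (parallel edges allowed, no self-loops), $n=|V|$. A $k$-cut is a partition of $V$ into $k$ nonempty sets; its weight is the number of edges joining different parts. $\lambda_k$ is the minimum weight of a $k$-cut of $G$, and $\overline\lambda_k:=\lambda_k/k$. A cut is a $2$-cut $\{C,V\setminus C\}$ (an unordered partition into two nonempty sets, often denoted just by $C$), and $\partial C$ is the set of edges between $C$ and $V\setminus C$. A cut $C$ is medium if $\frac{k}{k-1}\overline\lambda_k\le |\partial C|<2\overline\lambda_k$. -}

module Defs where

open import Data.Fin.Base using (Fin; zero; toℕ; fromℕ<; inject≤; funToFin; finToFun)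
open import Data.Fin.Properties
  using (_≟_; any?; all?; toℕ<n; toℕ-injective; toℕ-fromℕ<; toℕ-inject≤; finToFun-funToFin)
open import Data.Integer.Base using (+_)
open import Data.List.Base using (List; length; filter)
open import Data.List.Properties using (filter-≐)
open import Data.List.Relation.Unary.All using (All)
import Data.List.Relation.Unary.Unique.Setoid as UniqueSetoid
open import Data.Nat.Base
  using (ℕ; suc; _≤_; _<_; _∸_; s≤s; z≤n; NonZero; >-nonZero)
open import Data.Nat.Induction using (Acc; acc; <-wellFounded)
open import Data.Nat.Properties using (_<?_; ≤-trans; ≮⇒≥; m<n⇒0<n∸m)
open import Data.Product.Base using (Σ-syntax; ∃; ∃-syntax; _×_; _,_; proj₁; proj₂)
open import Data.Rational.Base as ℚ using (ℚ; _/_)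
open import Function.Bundles using (_↠_; _⇔_; mk↠ₛ; module Surjection)
open import Function.Definitions using (StrictlySurjective)
open import Function.Properties.Equivalence using (⇔-isEquivalence)
open import Level using (0ℓ)
open import Relation.Binary.Bundles using (Setoid)
open import Relation.Binary.PropositionalEquality
open import Relation.Binary.Structures using (IsEquivalence)
open import Relation.Nullary.Decidable using (Dec; yes; no; ¬?; _×-dec_)
open import Relation.Nullary.Negation using (contradiction)

-- The order in which an edge lists its two endpoints is irrelevant: everything
-- below is symmetric in them.  Repeated entries are parallel edges.
record Multigraph (n : ℕ) : Set where
  field
    edges   : List (Fin n × Fin n)
    no-loop : All (λ e → proj₁ e ≢ proj₂ e) edges

open Multigraph public

-- A partition of the vertices into k nonempty parts, given by the map sending a
-- vertex to the name of its part.  The names carry no meaning, so partitions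
-- are compared by KCut-setoid, not by _≡_.
KCut : ℕ → ℕ → Set
KCut n k = Fin n ↠ Fin k

part : ∀ {n k} → KCut n k → Fin n → Fin k
part = Surjection.to

infix 4 _≈_

_≈_ : ∀ {n k} → KCut n k → KCut n k → Set
c ≈ d = ∀ u v → part c u ≡ part c v ⇔ part d u ≡ part d v

KCut-setoid : ℕ → ℕ → Setoid 0ℓ 0ℓ
KCut-setoid n k = record
  { Carrier       = KCut n k
  ; _≈_           = _≈_
  ; isEquivalence = record
    { refl  = λ u v → E.refl
    ; sym   = λ c≈d u v → E.sym (c≈d u v)
    ; trans = λ c≈d d≈e u v → E.trans (c≈d u v) (d≈e u v)
    }
  }
  where module E = IsEquivalence (⇔-isEquivalence {0ℓ})

Cut : ℕ → Set
Cut n = KCut n 2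

crossing : ∀ {n k} → Multigraph n → (Fin n → Fin k) → List (Fin n × Fin n)
crossing G f = filter (λ e → ¬? (f (proj₁ e) ≟ f (proj₂ e))) (edges G)

weight : ∀ {n k} → Multigraph n → KCut n k → ℕ
weight G c = length (crossing G (part c))

∂ : ∀ {n} → Multigraph n → Cut n → List (Fin n × Fin n)
∂ G C = crossing G (part C)

IsMinWeight : ∀ {n} → Multigraph n → ℕ → ℕ → Set
IsMinWeight {n} G k w =
  (Σ[ c ∈ KCut n k ] weight G c ≡ w) × (∀ (c : KCut n k) → w ≤ weight G c)

private
  crossing-cong : ∀ {n k} (G : Multigraph n) {f g : Fin n → Fin k} →
                  f ≗ g → crossing G f ≡ crossing G g
  crossing-cong G f≗g = filter-≐ _ _
    ( (λ f≢ eq → f≢ (trans (f≗g _) (trans eq (sym (f≗g _)))))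
    , (λ g≢ eq → g≢ (trans (sym (f≗g _)) (trans eq (f≗g _)))))
    (edges G)

  surjective? : ∀ {n k} (f : Fin n → Fin k) → Dec (StrictlySurjective _≡_ f)
  surjective? f = all? λ j → any? λ i → f i ≟ j

  lighter? : ∀ {n} (G : Multigraph n) k w → Dec (Σ[ c ∈ KCut n k ] weight G c < w)
  lighter? G k w
    with any? (λ i → surjective? (finToFun i) ×-dec
                     (length (crossing G (finToFun {k} i)) <? w))
  ... | yes (i , surj , lt) = yes (mk↠ₛ surj , lt)
  ... | no none = no λ (c , lt) →
        let f = part c; f≗ = finToFun-funToFin f in
        none ( funToFin f
             , (λ j → let (i , eq) = Surjection.strictlySurjective c j in
                      i , trans (f≗ i) eq)
             , subst (_< w) (cong length (sym (crossing-cong G f≗))) lt)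

  someKCut : ∀ {n k} .{{_ : NonZero k}} → k ≤ n → KCut n k
  someKCut {n} {suc k} k≤n = mk↠ₛ {to = to} λ j → inject≤ j k≤n , to-inject j
    where
    to : Fin n → Fin (suc k)
    to i with toℕ i <? suc k
    ... | yes i<k = fromℕ< i<k
    ... | no  _   = zero

    to-inject : ∀ j → to (inject≤ j k≤n) ≡ j
    to-inject j with toℕ (inject≤ j k≤n) <? suc k
    ... | yes i<k = toℕ-injective (trans (toℕ-fromℕ< i<k) (toℕ-inject≤ j k≤n))
    ... | no  i≮k =
      contradiction (subst (_< suc k) (sym (toℕ-inject≤ j k≤n)) (toℕ<n j)) i≮k

  descend : ∀ {n} (G : Multigraph n) {k} (c : KCut n k) →
            Acc _<_ (weight G c) → ∃ (IsMinWeight G k)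
  descend G {k} c (acc rec) with lighter? G k (weight G c)
  ... | yes (d , d<c) = descend G d (rec d<c)
  ... | no  none      = weight G c , (c , refl) , λ d → ≮⇒≥ λ d<c → none (d , d<c)

minWeight : ∀ {n} (G : Multigraph n) k .{{_ : NonZero k}} → k ≤ n →
            ∃[ w ] IsMinWeight G k w
minWeight G k k≤n = descend G (someKCut k≤n) (<-wellFounded _)

module _ {n} (G : Multigraph n) (k : ℕ) (3≤k : 3 ≤ k) (k≤n : k ≤ n) where

  private instance
    k≢0 : NonZero k
    k≢0 = >-nonZero (≤-trans (s≤s z≤n) 3≤k)

    k∸1≢0 : NonZero (k ∸ 1)
    k∸1≢0 = >-nonZero (m<n⇒0<n∸m (≤-trans (s≤s (s≤s z≤n)) 3≤k))

  λₖ : ℕ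
  λₖ = proj₁ (minWeight G k k≤n)

  λ̄ₖ : ℚ
  λ̄ₖ = + λₖ / k

  Medium : Cut n → Set
  Medium C = (+ k / (k ∸ 1)) ℚ.* λ̄ₖ ℚ.≤ ∣∂C∣ × ∣∂C∣ ℚ.< (+ 2 / 1) ℚ.* λ̄ₖ
    where
    ∣∂C∣ : ℚ
    ∣∂C∣ = + length (∂ G C) / 1

-- At most N elements of S, counted up to its equality, satisfy P.
AtMost : ∀ {a ℓ p} (S : Setoid a ℓ) → ℕ → (Setoid.Carrier S → Set p) → Set _
AtMost S N P = ∀ xs → UniqueSetoid.Unique S xs → All P xs → length xs ≤ N

{-# OPTIONS --safe #-}
module Submission where

open import Defs
open import Data.Bool.Base using (Bool; true; false; not; _∧_; if_then_else_)
import Data.Bool.Properties as 𝔹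
open import Data.Empty using (⊥; ⊥-elim)
open import Data.Fin.Base as Fin using (Fin; zero; suc)
import Data.Fin.Properties as F
open import Data.Fin.Subset as Subset using (Subset; ∣_∣; ∁)
open import Data.Fin.Subset.Properties
  using (anySubset?; ∣p∣≤n; p⊂q⇒∣p∣<∣q∣; p⊆q⇒∣p∣≤∣q∣)
import Data.Integer.Base as ℤ
import Data.Integer.Properties as ℤ
open import Data.List.Base as List using (List; []; _∷_; map; length; filter; _++_)
open import Data.List.Membership.Propositional using (_∈_; lose)
open import Data.List.Membership.Propositional.Properties
  using (∈-tabulate⁺; ∈-++⁺ˡ; ∈-++⁺ʳ; ∈-map⁺; ∈-concatMap⁺; ∈-allFin)
open import Data.List.Properties
  using (length-++; length-map; length-take; length-drop; length-tabulate; take++drop≡id; map-cong)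
open import Data.List.Relation.Unary.All as All using (All; []; _∷_)
import Data.List.Relation.Unary.All.Properties as All
open import Data.List.Relation.Unary.AllPairs as AllPairs using (AllPairs; []; _∷_)
import Data.List.Relation.Unary.AllPairs.Properties as AllPairs
open import Data.List.Relation.Unary.Any as Any using (Any; here; there)
import Data.List.Relation.Unary.Any.Properties as Any
open import Data.List.Relation.Unary.Unique.Propositional using (Unique)
import Data.List.Relation.Unary.Unique.Propositional.Properties as Unique
open import Data.Maybe.Base using (Maybe; just; nothing)
open import Data.Nat.Base
  using (ℕ; zero; suc; _≤_; _<_; _*_; _^_; _+_; _∸_; z≤n; s≤s; s≤s⁻¹; NonZero; >-nonZero)
open import Data.Nat.Induction using (Acc; acc; <-wellFounded)
open import Data.Nat.ListAction using (sum)
open import Data.Nat.Properties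
open import Data.Nat.Tactic.RingSolver using (solve-∀)
open import Data.Product.Base using (Σ-syntax; ∃; ∃₂; _×_; _,_; proj₁; proj₂)
open import Data.Rational.Base as ℚ using (_/_)
import Data.Rational.Properties as ℚ
open import Data.Rational.Unnormalised.Base as ℚᵘ using (mkℚᵘ; _≃_)
import Data.Rational.Unnormalised.Properties as ℚᵘ
open import Data.Sum.Base using (_⊎_; inj₁; inj₂)
open import Data.Sum.Properties as Sum using (inj₁-injective; inj₂-injective)
open import Data.Unit.Base using (tt)
open import Data.Vec.Base using (lookup; []; _∷_; tabulate; _[_]≔_; replicate)
import Data.Vec.Properties as V
open import Function.Base using (_∘_; id; case_of_)
open import Function.Bundles using (_⇔_; mk⇔; mk↠ₛ; module Equivalence)
open import Function.Definitions using (StrictlySurjective)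
open import Function.Properties.Equivalence using (⇔-isEquivalence)
open import Level using (0ℓ)
open import Relation.Binary.Definitions using (DecidableEquality)
open import Relation.Binary.PropositionalEquality
open import Relation.Binary.Structures using (IsEquivalence)
open import Relation.Nullary.Decidable using (Dec; yes; no; does; ¬?; _×-dec_)
open import Relation.Nullary.Negation using (¬_; contradiction)

-- Call a cut light if it costs less than 2 λₖ / k; every medium cut is light.  Starting from a
-- light cut, or from the partition with one part, keep splitting parts as long as a split costs
-- at most λₖ / k.  The average cost of a part stays below λₖ / k, so this stops with fewer than
-- k parts, the atoms, and then a light cut splits at most one atom, as two splits would cost
-- more than 2 λₖ / k.
--
-- If a light cut X has more than k vertices on both sides, then each light cut leaves the atoms
-- on one side of X whole and survives the contraction of these atoms; as there are fewer than k
-- atoms, induction on the number of vertices gives a linear bound.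
--
-- Otherwise every light cut has a side A with at most k vertices.  There are few A that are
-- unions of atoms; any other A contains some vertex o but not the whole atom of o.  Fix o.  In a
-- sunflower of such sets whose kernel Y contains o, the kernel splits the atom of o, so it costs
-- more than λₖ / k, which makes the petals so cheap that 2 (k - 1) of them give two partitions
-- into k parts of total cost below 2 λₖ.  So there is no such sunflower, and the sunflower
-- lemma leaves at most k^O(k) sets for each o.

private variable
  m n j : ℕ
  A B   : Set

-- Weighted sums over lists

weigh : List A → (A → ℕ) → ℕ
weigh xs f = sum (map f xs)

weigh-monoᴬ : ∀ {xs : List A} {f g : A → ℕ} → All (λ x → f x ≤ g x) xs → weigh xs f ≤ weigh xs g
weigh-monoᴬ []          = z≤n
weigh-monoᴬ (le ∷ f≤g) = +-mono-≤ le (weigh-monoᴬ f≤g)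

weigh-mono : ∀ (xs : List A) {f g : A → ℕ} → (∀ x → f x ≤ g x) → weigh xs f ≤ weigh xs g
weigh-mono xs f≤g = weigh-monoᴬ (All.universal f≤g xs)

weigh-+ : ∀ (xs : List A) (f g : A → ℕ) → weigh xs (λ x → f x + g x) ≡ weigh xs f + weigh xs g
weigh-+ []       f g = refl
weigh-+ (x ∷ xs) f g rewrite weigh-+ xs f g = regroup (f x) (g x) (weigh xs f) (weigh xs g)
  where
  regroup : ∀ a b c d → a + b + (c + d) ≡ a + c + (b + d)
  regroup = solve-∀

weigh-* : ∀ (xs : List A) r (f : A → ℕ) → weigh xs (λ x → r * f x) ≡ r * weigh xs f
weigh-* []       r f = sym (*-zeroʳ r)
weigh-* (x ∷ xs) r f rewrite weigh-* xs r f = sym (*-distribˡ-+ r (f x) _)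

weigh-const : ∀ (xs : List A) r → weigh xs (λ _ → r) ≡ length xs * r
weigh-const []       r = refl
weigh-const (x ∷ xs) r = cong (r +_) (weigh-const xs r)

weigh-0 : ∀ (xs : List A) → weigh xs (λ _ → 0) ≡ 0
weigh-0 xs = trans (weigh-const xs 0) (*-zeroʳ (length xs))

weigh-swap : ∀ (xs : List A) (ys : List B) (f : A → B → ℕ) →
             weigh xs (λ x → weigh ys (f x)) ≡ weigh ys (λ y → weigh xs (λ x → f x y))
weigh-swap []       ys f = sym (weigh-0 ys)
weigh-swap (x ∷ xs) ys f =
  trans (cong (weigh ys (f x) +_) (weigh-swap xs ys f)) (sym (weigh-+ ys (f x) _))

weigh-map : ∀ (h : A → B) xs (f : B → ℕ) → weigh (map h xs) f ≡ weigh xs (f ∘ h)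
weigh-map h []       f = refl
weigh-map h (x ∷ xs) f = cong (f (h x) +_) (weigh-map h xs f)

weigh-++ : ∀ (xs ys : List A) f → weigh (xs ++ ys) f ≡ weigh xs f + weigh ys f
weigh-++ []       ys f = refl
weigh-++ (x ∷ xs) ys f =
  trans (cong (f x +_) (weigh-++ xs ys f)) (sym (+-assoc (f x) _ _))

-- Costs of partitions and cuts, and splitting a part

δ : DecidableEquality A → A → A → ℕ
δ _≟_ x y = if does (x ≟ y) then 0 else 1

δ≤1 : (_≟_ : DecidableEquality A) (x y : A) → δ _≟_ x y ≤ 1
δ≤1 _≟_ x y with x ≟ y
... | yes _ = z≤n
... | no  _ = ≤-refl

δ-≡ : (_≟_ : DecidableEquality A) {x y : A} → x ≡ y → δ _≟_ x y ≡ 0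
δ-≡ _≟_ {x} {y} eq with x ≟ y
... | yes _ = refl
... | no ¬p = contradiction eq ¬p

δ-mono : (_≟ᴬ_ : DecidableEquality A) (_≟ᴮ_ : DecidableEquality B) {x y : A} {x′ y′ : B} →
         (x′ ≡ y′ → x ≡ y) → δ _≟ᴬ_ x y ≤ δ _≟ᴮ_ x′ y′
δ-mono _≟ᴬ_ _≟ᴮ_ {x} {y} {x′} {y′} f with x′ ≟ᴮ y′
... | yes p = ≤-reflexive (δ-≡ _≟ᴬ_ (f p))
... | no  _ = δ≤1 _≟ᴬ_ x y

-- Loops are allowed here, so that contracting a graph is just relabelling its edges.
Edges : ℕ → Set
Edges m = List (Fin m × Fin m)

-- Counts the edges whose ends get distinct labels, as `δ` is 1 exactly off the diagonal. The label
-- type is a parameter so that `cost-mono` can compare partitions, labelled by `Fin j`, with cuts,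
-- labelled by `Bool`.
cost : DecidableEquality A → Edges m → (Fin m → A) → ℕ
cost _≟_ E c = weigh E λ (u , v) → δ _≟_ (c u) (c v)

partitionCost : Edges m → (Fin m → Fin j) → ℕ
partitionCost = cost F._≟_

cutCost : Edges m → (Fin m → Bool) → ℕ
cutCost = cost 𝔹._≟_

-- Edges leaving part `i` are already paid for by `c`, so this is what splitting the part by `χ`
-- adds to the cost.
innerCost : Edges m → (Fin m → Fin j) → Fin j → (Fin m → Bool) → ℕ
innerCost E c i χ = weigh E λ (u , v) →
  if does (c u F.≟ i) ∧ does (c v F.≟ i) then δ 𝔹._≟_ (χ u) (χ v) else 0

Splits : (Fin m → Fin j) → Fin j → (Fin m → Bool) → Set
Splits c i χ = ∃₂ λ u v → (c u ≡ i × χ u ≡ true) × (c v ≡ i × χ v ≡ false)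

splits? : ∀ (c : Fin m → Fin j) i χ → Dec (Splits c i χ)
splits? c i χ = F.any? λ u → F.any? λ v →
  (c u F.≟ i ×-dec χ u 𝔹.≟ true) ×-dec (c v F.≟ i ×-dec χ v 𝔹.≟ false)

split : (Fin m → Fin j) → Fin j → (Fin m → Bool) → Fin m → Fin (suc j)
split c i χ v = if does (c v F.≟ i) ∧ χ v then zero else suc (c v)

cost-mono : (_≟ᴬ_ : DecidableEquality A) (_≟ᴮ_ : DecidableEquality B)
            (E : Edges m) {c : Fin m → A} {d : Fin m → B} →
            (∀ u v → d u ≡ d v → c u ≡ c v) → cost _≟ᴬ_ E c ≤ cost _≟ᴮ_ E d
cost-mono _≟ᴬ_ _≟ᴮ_ E f = weigh-mono E λ (u , v) → δ-mono _≟ᴬ_ _≟ᴮ_ (f u v)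

innerCost≤cutCost : ∀ (E : Edges m) (c : Fin m → Fin j) i χ → innerCost E c i χ ≤ cutCost E χ
innerCost≤cutCost E c i χ = weigh-mono E λ (u , v) →
  aux (does (c u F.≟ i) ∧ does (c v F.≟ i))
  where
  aux : ∀ b {k} → (if b then k else 0) ≤ k
  aux true  = ≤-refl
  aux false = z≤n

-- An edge lies inside at most one of two distinct parts.
innerCost-+ : ∀ (E : Edges m) (c : Fin m → Fin j) {i i′} χ → i ≢ i′ →
              innerCost E c i χ + innerCost E c i′ χ ≤ cutCost E χ
innerCost-+ E c {i} {i′} χ i≢i′ =
  subst (_≤ cutCost E χ) (weigh-+ E _ _) (weigh-mono E λ (u , v) →
    pointwise (c u F.≟ i) (c u F.≟ i′) (does (c v F.≟ i)) (does (c v F.≟ i′)))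
  where
  pointwise : ∀ {x} (p : Dec (x ≡ i)) (p′ : Dec (x ≡ i′)) b b′ {e} →
    (if does p ∧ b then e else 0) + (if does p′ ∧ b′ then e else 0) ≤ e
  pointwise (yes p) (yes q) _     _     = contradiction (trans (sym p) q) i≢i′
  pointwise (no _)  (no _)  _     _     = z≤n
  pointwise (yes _) (no _)  true  _     = ≤-reflexive (+-identityʳ _)
  pointwise (yes _) (no _)  false _     = z≤n
  pointwise (no _)  (yes _) _     true  = ≤-refl
  pointwise (no _)  (yes _) _     false = z≤n

-- An edge crossing the refined partition crosses `c`, or lies inside part `i` and crosses `χ`.
partitionCost-split : ∀ (E : Edges m) (c : Fin m → Fin j) i χ →
  partitionCost E (split c i χ) ≤ partitionCost E c + innerCost E c i χ
partitionCost-split E c i χ =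
  subst (partitionCost E (split c i χ) ≤_) (weigh-+ E _ _) (weigh-mono E pointwise)
  where
  pointwise : ∀ ((u , v) : _ × _) → δ F._≟_ (split c i χ u) (split c i χ v) ≤
    δ F._≟_ (c u) (c v) +
    (if does (c u F.≟ i) ∧ does (c v F.≟ i) then δ 𝔹._≟_ (χ u) (χ v) else 0)
  pointwise (u , v) with c u F.≟ c v
  ... | no  _ = ≤-trans (δ≤1 F._≟_ (split c i χ u) (split c i χ v)) (m≤m+n 1 _)
  ... | yes p with c u F.≟ i | c v F.≟ i
  ... | no _  | no _  = ≤-reflexive (δ-≡ F._≟_ (cong suc p))
  ... | yes q | no ¬q = contradiction (trans (sym p) q) ¬q
  ... | no ¬q | yes q = contradiction (trans p q) ¬q
  ... | yes _ | yes _ with χ u | χ v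
  ... | true  | true  = z≤n
  ... | true  | false = ≤-refl
  ... | false | true  = ≤-refl
  ... | false | false = ≤-reflexive (δ-≡ F._≟_ (cong suc p))

split-surjective : ∀ {c : Fin m → Fin j} {i χ} → StrictlySurjective _≡_ c → Splits c i χ →
                   StrictlySurjective _≡_ (split c i χ)
split-surjective {c = c} {i} {χ} surj (u , v , (cu≡i , χu) , (cv≡i , χv)) = hit
  where
  new : split c i χ u ≡ zero
  new with c u F.≟ i
  ... | yes _ rewrite χu = refl
  ... | no ¬p = contradiction cu≡i ¬p
  old : ∀ i′ → ∃ λ w → split c i χ w ≡ suc i′
  old i′ with i′ F.≟ i
  ... | yes refl = v , eq
    where
    eq : split c i χ v ≡ suc i
    eq with c v F.≟ i
    ... | yes p rewrite χv = cong suc p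
    ... | no ¬p = contradiction cv≡i ¬p
  ... | no i′≢i = let w , cw≡i′ = surj i′ in w , eq w cw≡i′
    where
    eq : ∀ w → c w ≡ i′ → split c i χ w ≡ suc i′
    eq w cw≡i′ with c w F.≟ i
    ... | yes p = contradiction (trans (sym cw≡i′) p) i′≢i
    ... | no  _ = cong suc cw≡i′
  hit : StrictlySurjective _≡_ (split c i χ)
  hit zero     = u , new
  hit (suc i′) = old i′

split-refines : ∀ (c : Fin m → Fin j) i χ u v → split c i χ u ≡ split c i χ v → c u ≡ c v
split-refines c i χ u v eq with c u F.≟ i | c v F.≟ i
... | no _  | no _  = F.suc-injective eq
... | yes p | yes q = trans p (sym q)
... | yes p | no _  with χ u
...   | true  = contradiction eq λ ()
...   | false = F.suc-injective eq
split-refines c i χ u v eq | no _ | yes q with χ v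
...   | true  = contradiction eq λ ()
...   | false = F.suc-injective eq

-- Subsets and lists

lookup-ext : ∀ {X Y : Subset m} → (∀ v → lookup X v ≡ lookup Y v) → X ≡ Y
lookup-ext {X = X} {Y} eq = trans (sym (V.tabulate∘lookup X))
  (trans (V.tabulate-cong eq) (V.tabulate∘lookup Y))

enum : (X : Subset m) → Fin ∣ X ∣ → Fin m
enum (true  ∷ X) zero    = zero
enum (true  ∷ X) (suc i) = suc (enum X i)
enum (false ∷ X) i       = suc (enum X i)

enum-∈ : ∀ (X : Subset m) i → lookup X (enum X i) ≡ true
enum-∈ (true  ∷ X) zero    = refl
enum-∈ (true  ∷ X) (suc i) = enum-∈ X i
enum-∈ (false ∷ X) i       = enum-∈ X i

enum-injective : ∀ (X : Subset m) {i i′} → enum X i ≡ enum X i′ → i ≡ i′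
enum-injective (true  ∷ X) {zero}  {zero}   eq = refl
enum-injective (true  ∷ X) {suc i} {suc i′} eq =
  cong suc (enum-injective X (F.suc-injective eq))
enum-injective (false ∷ X) eq = enum-injective X (F.suc-injective eq)

enum-surjective : ∀ (X : Subset m) v → lookup X v ≡ true → ∃ λ i → enum X i ≡ v
enum-surjective (true  ∷ X) zero    _   = zero , refl
enum-surjective (true  ∷ X) (suc v) v∈X =
  let i , eq = enum-surjective X v v∈X in suc i , cong suc eq
enum-surjective (false ∷ X) (suc v) v∈X =
  let i , eq = enum-surjective X v v∈X in i , cong suc eq

elements : Subset m → List (Fin m)
elements X = List.tabulate (enum X)

∈-elements : ∀ (X : Subset m) {v} → lookup X v ≡ true → v ∈ elements X
∈-elements X {v} v∈X = let i , eq = enum-surjective X v v∈X in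
  subst (_∈ elements X) eq (∈-tabulate⁺ i)

collision : ∀ (c : Fin m → Fin j) (X : Subset m) → j < ∣ X ∣ →
  ∃₂ λ u v → u ≢ v × lookup X u ≡ true × lookup X v ≡ true × c u ≡ c v
collision c X j<∣X∣ =
  let i , i′ , i<i′ , eq = F.pigeonhole j<∣X∣ (c ∘ enum X) in
  enum X i , enum X i′ , F.<⇒≢ i<i′ ∘ enum-injective X , enum-∈ X i , enum-∈ X i′ , eq

subsets : ∀ m → List (Subset m)
subsets zero    = [] ∷ []
subsets (suc m) = map (true ∷_) (subsets m) ++ map (false ∷_) (subsets m)

length-subsets : ∀ m → length (subsets m) ≡ 2 ^ m
length-subsets zero    = refl
length-subsets (suc m) = begin
  length (subsets (suc m))
    ≡⟨ length-++ (map (true ∷_) (subsets m)) ⟩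
  length (map (true ∷_) (subsets m)) + length (map (false ∷_) (subsets m))
    ≡⟨ cong₂ _+_ (length-map _ (subsets m)) (length-map _ (subsets m)) ⟩
  length (subsets m) + length (subsets m)
    ≡⟨ cong₂ _+_ (length-subsets m) (trans (length-subsets m) (sym (+-identityʳ _))) ⟩
  2 ^ suc m
    ∎
  where open ≡-Reasoning

∈-subsets : ∀ (X : Subset m) → X ∈ subsets m
∈-subsets []          = here refl
∈-subsets (true  ∷ X) = ∈-++⁺ˡ (∈-map⁺ _ (∈-subsets X))
∈-subsets (false ∷ X) = ∈-++⁺ʳ _ (∈-map⁺ _ (∈-subsets X))

length-filter-+ : ∀ {P : A → Set} (P? : ∀ x → Dec (P x)) xs →
  length (filter P? xs) + length (filter (¬? ∘ P?) xs) ≡ length xs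
length-filter-+ P? []       = refl
length-filter-+ P? (x ∷ xs) with does (P? x)
... | true  = cong suc (length-filter-+ P? xs)
... | false = trans (+-suc _ _) (cong suc (length-filter-+ P? xs))

unique-constant : ∀ {x : A} {xs} → Unique xs → All (_≡ x) xs → length xs ≤ 1
unique-constant []              _                 = z≤n
unique-constant (_ ∷ [])        _                 = ≤-refl
unique-constant ((x≢y ∷ _) ∷ _) (refl ∷ refl ∷ _) = contradiction refl x≢y

unique-map : ∀ {P : A → Set} {f : A → B} → (∀ {x y} → P x → P y → f x ≡ f y → x ≡ y) →
             ∀ {xs} → All P xs → Unique xs → Unique (map f xs)
unique-map inj []         []         = []
unique-map inj (Px ∷ Pxs) (x≢ ∷ xs!) =
  All.map⁺ (All.zipWith (λ (Py , x≢y) eq → x≢y (inj Px Py eq)) (Pxs , x≢)) ∷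
  unique-map inj Pxs xs!

-- Union bound: the elements with the first index are filtered out, at most `b` of them, and the
-- rest is covered by the later indices. `Q` is side information that filtering preserves.
cover : ∀ {I : Set} {P : I → A → Set} (P? : ∀ i x → Dec (P i x)) {Q : A → Set} {b} →
  (∀ i {ys} → Unique ys → All Q ys → All (P i) ys → length ys ≤ b) →
  ∀ is {xs} → Unique xs → All Q xs → All (λ x → Any (λ i → P i x) is) xs →
  length xs ≤ length is * b
cover P? bound []       _   _   []       = z≤n
cover {P = P} P? {Q} {b} bound (i ∷ is) {xs} xs! Qxs covered = begin
  length xs
    ≡⟨ sym (length-filter-+ (P? i) xs) ⟩
  length (filter (P? i) xs) + length rest
    ≤⟨ +-mono-≤ (bound i (Unique.filter⁺ (P? i) xs!) (All.filter⁺ (P? i) Qxs)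
                  (All.all-filter (P? i) xs))
                (cover P? bound is (Unique.filter⁺ (¬? ∘ P? i) xs!) (All.filter⁺ (¬? ∘ P? i) Qxs)
                  (All.zipWith later
                    (All.all-filter (¬? ∘ P? i) xs , All.filter⁺ (¬? ∘ P? i) covered))) ⟩
  b + length is * b
    ∎
  where
  open ≤-Reasoning
  rest = filter (¬? ∘ P? i) xs
  later : ∀ {x} → ¬ P i x × Any (λ i → P i x) (i ∷ is) → Any (λ i → P i x) is
  later (¬Pix , here Pix) = contradiction Pix ¬Pix
  later (_    , there p)  = p

-- Sunflowers

-- Each vertex goes to the first set containing it; the vertices outside all sets form one further
-- part, hence the `suc`.
labels : (χs : List (Fin m → Bool)) → Fin m → Fin (suc (length χs))
labels []       v = zero
labels (χ ∷ χs) v = if χ v then zero else suc (labels χs v)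

-- Vertices that every set in `χs` treats alike get the same label, so an edge between different
-- parts crosses at least one of the sets.
partitionCost-labels : ∀ (E : Edges m) χs → partitionCost E (labels χs) ≤ weigh χs (cutCost E)
partitionCost-labels E []       = ≤-reflexive (weigh-0 E)
partitionCost-labels E (χ ∷ χs) = begin
  partitionCost E (labels (χ ∷ χs))
    ≤⟨ weigh-mono E pointwise ⟩
  weigh E (λ (u , v) → δ 𝔹._≟_ (χ u) (χ v) + δ F._≟_ (labels χs u) (labels χs v))
    ≡⟨ weigh-+ E _ _ ⟩
  cutCost E χ + partitionCost E (labels χs)
    ≤⟨ +-monoʳ-≤ _ (partitionCost-labels E χs) ⟩
  cutCost E χ + weigh χs (cutCost E)
    ∎
  where
  open ≤-Reasoning
  pointwise : ∀ ((u , v) : _ × _) →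
    δ F._≟_ (labels (χ ∷ χs) u) (labels (χ ∷ χs) v) ≤
    δ 𝔹._≟_ (χ u) (χ v) + δ F._≟_ (labels χs u) (labels χs v)
  pointwise (u , v) with χ u | χ v
  ... | true  | true  = z≤n
  ... | true  | false = s≤s z≤n
  ... | false | true  = s≤s z≤n
  ... | false | false = ≤-refl

Disjoint : (χ ψ : Fin m → Bool) → Set
Disjoint χ ψ = ∀ v → χ v ≡ true → ψ v ≡ true → ⊥

labels-surjective : ∀ {χs : List (Fin m → Bool)} → AllPairs Disjoint χs →
  All (λ χ → ∃ λ v → χ v ≡ true) χs → ∀ o → All (λ χ → χ o ≡ false) χs →
  StrictlySurjective _≡_ (labels χs)
labels-surjective disjoint nonempty o o∉ i = let w , eq , _ = hit disjoint nonempty o∉ i in w , eq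
  where
  -- Recording that the witness is `o` or lies in a listed set shows, by disjointness, that no set
  -- put in front captures it.
  hit : ∀ {χs} → AllPairs Disjoint χs → All (λ χ → ∃ λ v → χ v ≡ true) χs →
        All (λ χ → χ o ≡ false) χs → ∀ i →
        ∃ λ w → labels χs w ≡ i × (w ≡ o ⊎ Any (λ χ → χ w ≡ true) χs)
  hit []        []             []         zero    = o , refl , inj₁ refl
  hit (_ ∷ _)   ((v , χv) ∷ _) _          zero    =
    v , cong (if_then zero else _) χv , inj₂ (here χv)
  hit {χ ∷ χs} (χ⊥ ∷ disj) (_ ∷ nonemp) (χo ∷ o∉) (suc i) with hit disj nonemp o∉ i
  ... | w , eq , w∈ =
    w , trans (cong (if_then zero else suc (labels χs w)) (χw w∈)) (cong suc eq) , later w∈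
    where
    χw : w ≡ o ⊎ Any (λ ψ → ψ w ≡ true) χs → χ w ≡ false
    χw (inj₁ refl) = χo
    χw (inj₂ ψw)   = 𝔹.¬-not λ χw → All.lookupWith {R = λ _ → ⊥} (λ χ⊥ψ → χ⊥ψ w χw) χ⊥ ψw
    later : w ≡ o ⊎ Any (λ ψ → ψ w ≡ true) χs → w ≡ o ⊎ Any (λ ψ → ψ w ≡ true) (χ ∷ χs)
    later (inj₁ eq) = inj₁ eq
    later (inj₂ ψw) = inj₂ (there ψw)

infix 4 _⊆ˢ_

_⊆ˢ_ : Subset m → Subset m → Set
Y ⊆ˢ A = ∀ v → lookup Y v ≡ true → lookup A v ≡ true

petal : Subset m → Subset m → Fin m → Bool
petal Y A v = lookup A v ∧ not (lookup Y v)

-- Petals are required to be nonempty because they will serve as parts of a partition.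
IsPetal : Subset m → Subset m → Set
IsPetal Y A = Y ⊆ˢ A × ∃ λ v → petal Y A v ≡ true

record IsSunflower (Y : Subset m) (As : List (Subset m)) : Set where
  constructor sunflower
  field
    petals : All (IsPetal Y) As
    apart  : AllPairs (λ A B → Disjoint (petal Y A) (petal Y B)) As

petal-true : ∀ (Y A : Subset m) {v} → lookup A v ≡ true → lookup Y v ≡ false → petal Y A v ≡ true
petal-true Y A v∈A v∉Y = cong₂ (λ a y → a ∧ not y) v∈A v∉Y

petal-∈ : ∀ (Y A : Subset m) {v} → petal Y A v ≡ true → lookup A v ≡ true × lookup Y v ≡ false
petal-∈ Y A {v} eq with lookup A v | lookup Y v
... | true | false = refl , refl

-- Both sides of each edge inequality agree unless the edge leaves the kernel Y; then the other
-- end lies in at most one petal.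
sunflower-cost : ∀ (E : Edges m) {Y As} → IsSunflower Y As →
  weigh As (cutCost E ∘ petal Y) + length As * cutCost E (lookup Y) ≤
  weigh As (cutCost E ∘ lookup) + 2 * cutCost E (lookup Y)
sunflower-cost {m} E {Y} {As} (sunflower petals apart) = begin
  weigh As (cutCost E ∘ petal Y) + length As * cutCost E (lookup Y)
    ≡⟨ cong₂ _+_ (weigh-swap As E _) (sym (weigh-* E (length As) _)) ⟩
  _ ≡⟨ sym (weigh-+ E _ _) ⟩
  _ ≤⟨ weigh-mono E (λ (u , v) → pointwise u v) ⟩
  _ ≡⟨ weigh-+ E _ _ ⟩
  _ ≡⟨ cong₂ _+_ (sym (weigh-swap As E _)) (weigh-* E 2 _) ⟩
  weigh As (cutCost E ∘ lookup) + 2 * cutCost E (lookup Y)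
    ∎
  where
  open ≤-Reasoning

  absent : ∀ {As} v → All (λ A → lookup A v ≡ false) As →
           weigh As (λ A → δ 𝔹._≟_ false (lookup A v)) + length As ≤
           weigh As (λ A → δ 𝔹._≟_ true (lookup A v))
  absent          v []         = z≤n
  absent {A ∷ As} v (v∉A ∷ v∉) rewrite v∉A =
    ≤-trans (≤-reflexive (+-suc _ _)) (s≤s (absent v v∉))

  -- A set avoiding `v` adds 1 to both sides; the only set that may contain `v` adds 2 on the left
  -- and 0 on the right, whence the constant 2.
  atMostOnce : ∀ {As} v → AllPairs (λ A B → lookup A v ≡ true → lookup B v ≡ true → ⊥) As →
               weigh As (λ A → δ 𝔹._≟_ false (lookup A v)) + length As ≤
               weigh As (λ A → δ 𝔹._≟_ true (lookup A v)) + 2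
  atMostOnce          v []        = z≤n
  atMostOnce {A ∷ As} v (A⊥ ∷ ap) with lookup A v
  ... | false = ≤-trans (≤-reflexive (+-suc _ _)) (s≤s (atMostOnce v ap))
  ... | true  = ≤-trans (≤-reflexive (cong suc (+-suc _ _)))
    (≤-trans (s≤s (s≤s (absent v (All.map (λ v⊥ → 𝔹.¬-not (v⊥ refl)) A⊥))))
             (≤-reflexive (+-comm 2 _)))

  leaving : ∀ u v → lookup Y u ≡ true → lookup Y v ≡ false →
            weigh As (λ A → δ 𝔹._≟_ (petal Y A u) (petal Y A v)) + length As ≤
            weigh As (λ A → δ 𝔹._≟_ (lookup A u) (lookup A v)) + 2
  leaving u v u∈Y v∉Y = begin
    weigh As (λ A → δ 𝔹._≟_ (petal Y A u) (petal Y A v)) + length As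
      ≡⟨ cong₂ (λ y y′ →
                 weigh As (λ A → δ 𝔹._≟_ (lookup A u ∧ not y) (lookup A v ∧ not y′)) + length As)
               u∈Y v∉Y ⟩
    weigh As (λ A → δ 𝔹._≟_ (lookup A u ∧ false) (lookup A v ∧ true)) + length As
      ≤⟨ +-monoˡ-≤ _ (weigh-mono As λ A →
           ≤-reflexive (cong₂ (δ 𝔹._≟_) (𝔹.∧-zeroʳ (lookup A u)) (𝔹.∧-identityʳ (lookup A v)))) ⟩
    weigh As (λ A → δ 𝔹._≟_ false (lookup A v)) + length As
      ≤⟨ atMostOnce v (AllPairs.map (λ {A} {B} disj v∈A v∈B →
           disj v (petal-true Y A v∈A v∉Y) (petal-true Y B v∈B v∉Y)) apart) ⟩
    weigh As (λ A → δ 𝔹._≟_ true (lookup A v)) + 2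
      ≤⟨ +-monoˡ-≤ _ (weigh-monoᴬ (All.map (λ {A} (Y⊆A , _) →
           ≤-reflexive (cong (λ a → δ 𝔹._≟_ a (lookup A v)) (sym (Y⊆A u u∈Y)))) petals)) ⟩
    weigh As (λ A → δ 𝔹._≟_ (lookup A u) (lookup A v)) + 2
      ∎

  δ-sym : ∀ a b → δ 𝔹._≟_ a b ≡ δ 𝔹._≟_ b a
  δ-sym true  true  = refl
  δ-sym true  false = refl
  δ-sym false true  = refl
  δ-sym false false = refl

  staying : ∀ u v {d} → lookup Y u ≡ lookup Y v → d ≡ 0 →
    weigh As (λ A → δ 𝔹._≟_ (petal Y A u) (petal Y A v)) + length As * d ≤
    weigh As (λ A → δ 𝔹._≟_ (lookup A u) (lookup A v)) + 2 * d
  staying u v eq refl = +-mono-≤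
    (weigh-mono As λ A → δ-mono 𝔹._≟_ 𝔹._≟_ {x′ = lookup A u} {lookup A v} λ a≡ →
      cong₂ (λ a y → a ∧ not y) a≡ eq)
    (≤-reflexive (*-zeroʳ (length As)))

  pointwise : ∀ u v →
    weigh As (λ A → δ 𝔹._≟_ (petal Y A u) (petal Y A v)) +
      length As * δ 𝔹._≟_ (lookup Y u) (lookup Y v) ≤
    weigh As (λ A → δ 𝔹._≟_ (lookup A u) (lookup A v)) + 2 * δ 𝔹._≟_ (lookup Y u) (lookup Y v)
  pointwise u v = aux (lookup Y u) (lookup Y v) refl refl
    where
    aux : ∀ y y′ → lookup Y u ≡ y → lookup Y v ≡ y′ →
      weigh As (λ A → δ 𝔹._≟_ (petal Y A u) (petal Y A v)) + length As * δ 𝔹._≟_ y y′ ≤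
      weigh As (λ A → δ 𝔹._≟_ (lookup A u) (lookup A v)) + 2 * δ 𝔹._≟_ y y′
    aux true  true  yu yv = staying u v (trans yu (sym yv)) refl
    aux false false yu yv = staying u v (trans yu (sym yv)) refl
    aux true  false yu yv rewrite *-identityʳ (length As) = leaving u v yu yv
    aux false true  yu yv rewrite *-identityʳ (length As) = subst₂ _≤_
      (cong (_+ length As) (flip u v (petal Y)))
      (cong (_+ 2) (flip u v lookup))
      (leaving v u yv yu)
      where
      flip : ∀ u v (χ : Subset m → Fin m → Bool) →
        weigh As (λ A → δ 𝔹._≟_ (χ A v) (χ A u)) ≡ weigh As (λ A → δ 𝔹._≟_ (χ A u) (χ A v))
      flip u v χ = cong sum (map-cong (λ A → δ-sym (χ A v) (χ A u)) As)

-- Enlarging the kernel and finding sunflowers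

card : (Fin m → Bool) → ℕ
card χ = ∣ tabulate χ ∣

∈-tabulate⇒ : ∀ (χ : Fin m → Bool) {v} → v Subset.∈ tabulate χ → χ v ≡ true
∈-tabulate⇒ χ {v} v∈ = trans (sym (V.lookup∘tabulate χ v)) (V.[]=⇒lookup v∈)

⇒∈-tabulate : ∀ (χ : Fin m → Bool) {v} → χ v ≡ true → v Subset.∈ tabulate χ
⇒∈-tabulate χ {v} χv = V.lookup⇒[]= v (tabulate χ) (trans (V.lookup∘tabulate χ v) χv)

card-mono-< : ∀ {χ ψ : Fin m → Bool} → (∀ v → χ v ≡ true → ψ v ≡ true) →
              ∀ u → ψ u ≡ true → χ u ≡ false → card χ < card ψ
card-mono-< {χ = χ} {ψ} χ⊆ψ u ψu χu = p⊂q⇒∣p∣<∣q∣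
  ( (λ {v} → ⇒∈-tabulate ψ ∘ χ⊆ψ v ∘ ∈-tabulate⇒ χ)
  , u , ⇒∈-tabulate ψ ψu , λ u∈ → case trans (sym χu) (∈-tabulate⇒ χ u∈) of λ ())

insert-⊆ : ∀ (Y A : Subset m) {u} → Y ⊆ˢ A → lookup A u ≡ true → (Y [ u ]≔ true) ⊆ˢ A
insert-⊆ Y A {u} Y⊆A u∈A v v∈ with v F.≟ u
... | yes refl = u∈A
... | no v≢u   = Y⊆A v (trans (sym (V.lookup∘update′ v≢u Y true)) v∈)

⊆-insert : ∀ (Y : Subset m) u → Y ⊆ˢ (Y [ u ]≔ true)
⊆-insert Y u v v∈Y with v F.≟ u
... | yes refl = V.lookup∘update u Y true
... | no v≢u   = trans (V.lookup∘update′ v≢u Y true) v∈Y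

-- The decreasing measure of `pinned-bound`: moving a point from the petal to the kernel shrinks the
-- petal.
petal-insert-< : ∀ (Y A : Subset m) {u} → petal Y A u ≡ true →
                 card (petal (Y [ u ]≔ true) A) < card (petal Y A)
petal-insert-< Y A {u} Au = card-mono-< shrink u Au
  (trans (cong (λ y → lookup A u ∧ not y) (V.lookup∘update u Y true)) (𝔹.∧-zeroʳ _))
  where
  shrink : ∀ v → petal (Y [ u ]≔ true) A v ≡ true → petal Y A v ≡ true
  shrink v Av = let v∈A , v∉Y′ = petal-∈ (Y [ u ]≔ true) A Av in
    petal-true Y A v∈A (𝔹.¬-not λ v∈Y → case trans (sym v∉Y′) (⊆-insert Y u v v∈Y) of λ ())

no-petal : ∀ {Y A : Subset m} → Y ⊆ˢ A → (∀ v → petal Y A v ≢ true) → A ≡ Y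
no-petal {Y = Y} {A} Y⊆A none = lookup-ext same
  where
  same : ∀ v → lookup A v ≡ lookup Y v
  same v with lookup Y v in v∈?Y
  ... | true  = Y⊆A v v∈?Y
  ... | false = 𝔹.¬-not λ v∈A → none v (petal-true Y A v∈A v∈?Y)

unions : Subset m → List (Subset m) → List (Fin m)
unions Y = List.concatMap (λ A → elements (tabulate (petal Y A)))

length-unions : ∀ (Y : Subset m) {d As} → All (λ A → card (petal Y A) ≤ d) As →
                length (unions Y As) ≤ length As * d
length-unions Y []                   = z≤n
length-unions Y {As = A ∷ As} (le ∷ les) = begin
  length (elements (tabulate (petal Y A)) ++ unions Y As)
    ≡⟨ length-++ (elements (tabulate (petal Y A))) ⟩
  length (elements (tabulate (petal Y A))) + length (unions Y As)
    ≤⟨ +-mono-≤ (≤-trans (≤-reflexive (length-tabulate _)) le) (length-unions Y les) ⟩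
  _ ∎
  where open ≤-Reasoning

∈-unions : ∀ (Y : Subset m) {As A v} → A ∈ As → petal Y A v ≡ true → v ∈ unions Y As
∈-unions Y {A = A} {v} A∈As Av = ∈-concatMap⁺ _ (lose A∈As
  (∈-elements (tabulate (petal Y A)) (trans (V.lookup∘tabulate (petal Y A) v) Av)))

-- A maximal sunflower with kernel Y either has r petals or its petals meet every other set.
findSunflower : ∀ (Y : Subset m) {Q : Subset m → Set} {d} →
  (∀ {A} → Q A → Y ⊆ˢ A) → (∀ {A} → Q A → card (petal Y A) ≤ d) →
  ∀ {xs} r → All Q xs →
  (Σ[ As ∈ List (Subset m) ] IsSunflower Y As × length As ≡ r × All Q As) ⊎
  (Σ[ U ∈ List (Fin m) ]
    length U ≤ r * d × All (λ A → A ≡ Y ⊎ Any (λ u → petal Y A u ≡ true) U) xs)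
findSunflower Y Y⊆ small zero Qxs = inj₁ ([] , sunflower [] [] , refl , [])
findSunflower {m} Y {Q} {d} Y⊆ small {xs} (suc r) Qxs with findSunflower Y Y⊆ small r Qxs
... | inj₂ (U , len , hit) = inj₂ (U , ≤-trans len (m≤n+m (r * d) d) , hit)
... | inj₁ (As , sunflower ps ap , refl , QAs)
  with Any.any? (λ A → F.any? (λ v → petal Y A v 𝔹.≟ true) ×-dec
                       ¬? (Any.any? (λ u → petal Y A u 𝔹.≟ true) (unions Y As))) xs
... | yes new =
  let QA , (v , Av) , A⊥ = All.lookupAny Qxs new in
  inj₁ ( _ ∷ As
       , sunflower ((Y⊆ QA , v , Av) ∷ ps)
           (All.tabulate (λ B∈As u Au Bu → A⊥ (lose (∈-unions Y B∈As Bu) Au)) ∷ ap)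
       , refl
       , QA ∷ QAs)
... | no none = inj₂
  (unions Y As , ≤-trans (length-unions Y (All.map small QAs)) (m≤n+m _ d) , All.tabulate meets)
  where
  meets : ∀ {A} → A ∈ xs → A ≡ Y ⊎ Any (λ u → petal Y A u ≡ true) (unions Y As)
  meets {A} A∈xs with Any.any? (λ u → petal Y A u 𝔹.≟ true) (unions Y As)
  ... | yes p = inj₂ p
  ... | no ¬p = inj₁ (no-petal (Y⊆ (All.lookup Qxs A∈xs)) λ v Av → none (lose A∈xs ((v , Av) , ¬p)))

preimage : (Fin m → Fin j) → Subset j → Subset m
preimage c X = tabulate (lookup X ∘ c)

-- `X` reads off `A` at one chosen vertex of each part. The one-sided hypothesis gives equality
-- because `u` and `v` can be exchanged.
preimage-surjective : ∀ {c : Fin m → Fin j} → StrictlySurjective _≡_ c → ∀ A →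
  (∀ u v → c u ≡ c v → lookup A u ≡ true → lookup A v ≡ true) →
  ∃ λ X → A ≡ preimage c X
preimage-surjective {c = c} surj A const = X , lookup-ext λ v → begin
    lookup A v                    ≡⟨ same (sym (proj₂ (surj (c v)))) ⟩
    lookup A (proj₁ (surj (c v))) ≡⟨ sym (V.lookup∘tabulate _ (c v)) ⟩
    lookup X (c v)                ≡⟨ sym (V.lookup∘tabulate _ v) ⟩
    lookup (preimage c X) v       ∎
  where
  open ≡-Reasoning
  X = tabulate λ i → lookup A (proj₁ (surj i))
  same : ∀ {u v} → c u ≡ c v → lookup A u ≡ lookup A v
  same {u} {v} eq with lookup A u in Au | lookup A v in Av
  ... | true  | true  = refl
  ... | false | false = refl
  ... | true  | false = trans (sym (const u v eq Au)) Av
  ... | false | true  = trans (sym Au) (const v u (sym eq) Av)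

card-petal : ∀ (Y A : Subset m) → card (petal Y A) ≤ ∣ A ∣
card-petal Y A = p⊆q⇒∣p∣≤∣q∣ λ {v} v∈ →
  V.lookup⇒[]= v A (proj₁ (petal-∈ Y A (∈-tabulate⇒ (petal Y A) v∈)))

-- Contractions

-- The quotient by the kernel of `g`, with classes numbered by `Fin size` so that a contracted graph
-- again has vertices in some `Fin`; `rep` is a section of `class`.
record Quotient (g : Fin m → A) : Set where
  field
    {size}   : ℕ
    class    : Fin m → Fin size
    rep      : Fin size → Fin m
    class-rep : ∀ x → class (rep x) ≡ x
    rep-class : ∀ v → g (rep (class v)) ≡ g v
    class-≡   : ∀ {u v} → g u ≡ g v → class u ≡ class v

-- Vertex `zero` joins the class of a later vertex with the same value if there is one, and opens a
-- new class otherwise.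
quotient : DecidableEquality A → ∀ (g : Fin m → A) → Quotient g
quotient {m = zero} _≟_ g = record
  { class = id ; rep = id ; class-rep = λ _ → refl ; rep-class = λ () ; class-≡ = λ { {()} } }
quotient {m = suc m} _≟_ g with quotient _≟_ (g ∘ suc) | F.any? (λ u → g (suc u) ≟ g zero)
... | q | yes (u , gu) = record
  { class     = cl
  ; rep       = suc ∘ rep
  ; class-rep = class-rep
  ; rep-class = λ { zero → trans (rep-class u) gu ; (suc v) → rep-class v }
  ; class-≡   = λ {x} {y} → eq x y
  }
  where
  open Quotient q
  cl : Fin (suc m) → Fin size
  cl zero    = class u
  cl (suc v) = class v
  eq : ∀ x y → g x ≡ g y → cl x ≡ cl y
  eq zero    zero    _ = refl
  eq zero    (suc y) p = class-≡ (trans gu p)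
  eq (suc x) zero    p = class-≡ (trans p (sym gu))
  eq (suc x) (suc y) p = class-≡ p
... | q | no new = record
  { class     = Fin.lift 1 class
  ; rep       = Fin.lift 1 rep
  ; class-rep = λ { zero → refl ; (suc x) → cong suc (class-rep x) }
  ; rep-class = λ { zero → refl ; (suc v) → rep-class v }
  ; class-≡   = λ {x} {y} → eq x y
  }
  where
  open Quotient q
  eq : ∀ x y → g x ≡ g y → Fin.lift 1 class x ≡ Fin.lift 1 class y
  eq zero    zero    _ = refl
  eq zero    (suc y) p = contradiction (y , sym p) new
  eq (suc x) zero    p = contradiction (x , p) new
  eq (suc x) (suc y) p = cong suc (class-≡ p)

module _ {g : Fin m → A} (q : Quotient g) where
  open Quotient q

  rep-injective : ∀ {x y} → g (rep x) ≡ g (rep y) → x ≡ y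
  rep-injective {x} {y} eq = trans (sym (class-rep x)) (trans (class-≡ eq) (class-rep y))

  -- As `u` and `v` share a class, one of them is not its representative; adding it to the
  -- representatives injects `Fin (suc size)` into `Fin m`.
  size-< : ∀ {u v} → u ≢ v → g u ≡ g v → size < m
  size-< {u} {v} u≢v gu≡gv = F.injective⇒≤ {f = h} (λ {x} {y} → h-injective x y)
    where
    missed : ∃ λ w → ∀ x → rep x ≢ w
    missed with rep (class u) F.≟ u
    ... | yes p = v , λ x rx≡v → u≢v (trans (sym p) (trans
      (cong rep (trans (class-≡ gu≡gv) (trans (cong class (sym rx≡v)) (class-rep x)))) rx≡v))
    ... | no ¬p = u , λ x rx≡u → ¬p (trans
      (cong rep (trans (cong class (sym rx≡u)) (class-rep x))) rx≡u)
    h : Fin (suc size) → Fin m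
    h zero    = proj₁ missed
    h (suc x) = rep x
    h-injective : ∀ x y → h x ≡ h y → x ≡ y
    h-injective zero    zero    _  = refl
    h-injective zero    (suc y) eq = contradiction (sym eq) (proj₂ missed y)
    h-injective (suc x) zero    eq = contradiction eq (proj₂ missed x)
    h-injective (suc x) (suc y) eq = cong suc (rep-injective (cong g eq))

join-injective : ∀ m {n} {x y : Fin m ⊎ Fin n} → Fin.join m n x ≡ Fin.join m n y → x ≡ y
join-injective m eq = trans (sym (F.splitAt-join m _ _))
  (trans (cong (Fin.splitAt m) eq) (F.splitAt-join m _ _))

splitAt-injective : ∀ m {n} {i i′ : Fin (m + n)} → Fin.splitAt m i ≡ Fin.splitAt m i′ → i ≡ i′
splitAt-injective m eq = trans (sym (F.join-splitAt m _ _))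
  (trans (cong (Fin.join m _) eq) (F.join-splitAt m _ _))

-- The map whose kernel gives the contraction keeping side `b` of `X`: the tag `inj₁` leaves
-- vertices of that side apart, `inj₂` merges the others part by part.
keepSide : Subset m → (Fin m → Fin j) → Bool → Fin m → Fin m ⊎ Fin j
keepSide X c b v = if does (lookup X v 𝔹.≟ b) then inj₁ v else inj₂ (c v)

keepSide-contracted : ∀ (X : Subset m) (c : Fin m → Fin j) b {v} → lookup X v ≡ not b →
                      keepSide X c b v ≡ inj₂ (c v)
keepSide-contracted X c b {v} eq with lookup X v 𝔹.≟ b
... | yes p = contradiction (sym (trans (sym p) eq)) (𝔹.not-¬ refl ∘ sym)
... | no ¬p = refl

module _ (X : Subset m) (c : Fin m → Fin j) (refines : ∀ u v → c u ≡ c v → lookup X u ≡ lookup X v)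
  where

  keep : ∀ b → Quotient (keepSide X c b)
  keep b = quotient (Sum.≡-dec F._≟_ F._≟_) (keepSide X c b)

  sides-disjoint : ∀ u v → keepSide X c true u ≢ keepSide X c false v
  sides-disjoint u v eq with lookup X u in Xu | lookup X v in Xv
  ... | true  | true  = case eq of λ ()
  ... | false | false = case eq of λ ()
  ... | true  | false = case trans (sym Xu) (trans (cong (lookup X) (inj₁-injective eq)) Xv) of λ ()
  ... | false | true  = case trans (sym Xu) (trans (refines u v (inj₂-injective eq)) Xv) of λ ()

  -- A vertex stays apart in only one of the two contractions, and a part is merged in only one,
  -- since no part meets both sides of `X`. So the classes of both together inject into vertices
  -- plus parts.
  keep-size-+ : Quotient.size (keep true) + Quotient.size (keep false) ≤ m + j
  keep-size-+ = F.injective⇒≤ {f = Fin.join m j ∘ h ∘ Fin.splitAt (size (keep true))} λ eq →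
    splitAt-injective (size (keep true)) (h-injective _ _ (join-injective m eq))
    where
    open Quotient
    h : Fin (size (keep true)) ⊎ Fin (size (keep false)) → Fin m ⊎ Fin j
    h (inj₁ x) = keepSide X c true (rep (keep true) x)
    h (inj₂ y) = keepSide X c false (rep (keep false) y)
    h-injective : ∀ x y → h x ≡ h y → x ≡ y
    h-injective (inj₁ x) (inj₁ y) eq = cong inj₁ (rep-injective (keep true) eq)
    h-injective (inj₂ x) (inj₂ y) eq = cong inj₂ (rep-injective (keep false) eq)
    h-injective (inj₁ x) (inj₂ y) eq = contradiction eq (sides-disjoint _ _)
    h-injective (inj₂ x) (inj₁ y) eq = contradiction (sym eq) (sides-disjoint _ _)

  keep-size-< : ∀ b {u v} → u ≢ v → lookup X u ≡ not b → lookup X v ≡ not b → c u ≡ c v →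
                Quotient.size (keep b) < m
  keep-size-< b u≢v Xu Xv cu≡cv = size-< (keep b) u≢v (trans (keepSide-contracted X c b Xu)
    (trans (cong inj₂ cu≡cv) (sym (keepSide-contracted X c b Xv))))

  -- `A` separates two vertices that `keep b` identifies, so it does not survive that contraction.
  Cuts : Bool → Subset m → Set
  Cuts b A = ∃₂ λ u v → (lookup X u ≡ not b × c u ≡ c v) × (lookup A u ≡ true × lookup A v ≡ false)

  cuts? : ∀ b A → Dec (Cuts b A)
  cuts? b A = F.any? λ u → F.any? λ v → (lookup X u 𝔹.≟ not b ×-dec c u F.≟ c v) ×-dec
                                        (lookup A u 𝔹.≟ true ×-dec lookup A v 𝔹.≟ false)

  uncut-saturated : ∀ b {A} → ¬ Cuts b A → ∀ u v → keepSide X c b u ≡ keepSide X c b v →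
                    lookup A u ≡ lookup A v
  uncut-saturated b {A} uncut u v eq with lookup X u 𝔹.≟ b | lookup X v 𝔹.≟ b
  ... | yes _ | yes _ = cong (lookup A) (inj₁-injective eq)
  ... | no ¬p | no ¬q with lookup A u in Au | lookup A v in Av
  ...   | true  | true  = refl
  ...   | false | false = refl
  ...   | true  | false =
    contradiction (u , v , (𝔹.¬-not ¬p , inj₂-injective eq) , Au , Av) uncut
  ...   | false | true  =
    contradiction (v , u , (𝔹.¬-not ¬q , sym (inj₂-injective eq)) , Av , Au) uncut

-- If both sizes are at least `k`, then `a + b + 1 ≤ m + j + 1 ≤ m + k`, and `2 k` is subtracted.
-- Otherwise one difference is truncated to 0, and strictness for the other size, or `k < m`,
-- provides the extra 1.
∸-superadditive : ∀ {a b m j k} → a < m → b < m → a + b ≤ m + j → j < k → k < m →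
                 suc ((a ∸ k) + (b ∸ k)) ≤ m ∸ k
∸-superadditive {a} {b} {m} {j} {k} a<m b<m a+b≤ j<k k<m with ≤-total a k | ≤-total b k
... | inj₁ a≤k | _ rewrite m≤n⇒m∸n≡0 a≤k = ∸-< b<m
  where
  ∸-< : ∀ {b} → b < m → b ∸ k < m ∸ k
  ∸-< {b} b<m with ≤-total k b
  ... | inj₁ k≤b = ∸-monoˡ-< b<m k≤b
  ... | inj₂ b≤k rewrite m≤n⇒m∸n≡0 b≤k = m<n⇒0<n∸m k<m
... | inj₂ k≤a | inj₁ b≤k rewrite m≤n⇒m∸n≡0 b≤k | +-identityʳ (a ∸ k) = ∸-monoˡ-< a<m k≤a
... | inj₂ k≤a | inj₂ k≤b = m+n≤o⇒m≤o∸n (suc (a ∸ k + (b ∸ k))) (+-cancelʳ-≤ k _ _ (begin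
    suc (a ∸ k + (b ∸ k)) + k + k       ≡⟨ regroup (a ∸ k) (b ∸ k) k ⟩
    suc ((a ∸ k + k) + (b ∸ k + k))     ≡⟨ cong₂ (λ x y → suc (x + y)) (m∸n+n≡m k≤a) (m∸n+n≡m k≤b) ⟩
    suc (a + b)                         ≤⟨ s≤s a+b≤ ⟩
    suc (m + j)                         ≡⟨ sym (+-suc m j) ⟩
    m + suc j                           ≤⟨ +-monoʳ-≤ m j<k ⟩
    m + k                               ∎))
  where
  open ≤-Reasoning
  regroup : ∀ x y k → suc (x + y) + k + k ≡ suc ((x + k) + (y + k))
  regroup = solve-∀

-- Closed partitions and light cuts

-- Throughout, k L play the parts of k and λₖ: no partition into k parts costs less than L,
-- and a cut is light if it costs less than 2 L / k.
module _ (k L : ℕ) where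

  KBound : Edges m → Set
  KBound {m} E = ∀ (c : Fin m → Fin k) → StrictlySurjective _≡_ c → L ≤ partitionCost E c

  -- No split costs at most `L / k`; multiplying by `k` keeps the inequality in the natural numbers.
  Closed : Edges m → (Fin m → Fin j) → Set
  Closed {m} E c = ∀ i (X : Subset m) → Splits c i (lookup X) → L < k * innerCost E c i (lookup X)

  record Closure (E : Edges m) (c : Fin m → Fin j) : Set where
    field
      {size}     : ℕ
      atom       : Fin m → Fin size
      size<k     : size < k
      surjective : StrictlySurjective _≡_ atom
      refines    : ∀ u v → atom u ≡ atom v → c u ≡ c v
      closed     : Closed E atom

  atLeast : ∀ (E : Edges m) → KBound E → j ≡ k → (c : Fin m → Fin j) →
            StrictlySurjective _≡_ c → L ≤ partitionCost E c
  atLeast E bound refl = bound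

  -- `steps` counts the splits left before there would be `k` parts, which makes the recursion
  -- structural. Each split adds a part and at most `L / k` to the cost, so the last hypothesis is
  -- preserved; with `k` parts it would contradict `KBound`.
  closure : ∀ (E : Edges m) → KBound E → ∀ steps (c : Fin m → Fin j) → j + steps ≡ k →
            StrictlySurjective _≡_ c → k * partitionCost E c < j * L → Closure E c
  closure {j = j} E bound zero c eq surj cheap =
    contradiction (atLeast E bound j≡k c surj)
      (<⇒≱ (*-cancelˡ-< k _ _ (subst (λ i → k * partitionCost E c < i * L) j≡k cheap)))
    where
    j≡k = trans (sym (+-identityʳ j)) eq
  closure {j = j} E bound (suc steps) c eq surj cheap
    with anySubset? (λ X → F.any? λ i → splits? c i (lookup X) ×-dec
                                        (k * innerCost E c i (lookup X) ≤? L))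
  ... | no none = record
    { atom       = c
    ; size<k     = m+n≤o⇒m≤o _ (≤-reflexive (trans (sym (+-suc j steps)) eq))
    ; surjective = surj
    ; refines    = λ u v → id
    ; closed     = λ i X s → ≰⇒> λ le → none (X , i , s , le)
    }
  ... | yes (X , i , s , le) = record
    { Closure rec
    ; refines = λ u v → split-refines c i χ u v ∘ Closure.refines rec u v
    }
    where
    χ = lookup X
    cheap′ : k * partitionCost E (split c i χ) < suc j * L
    cheap′ = begin-strict
      k * partitionCost E (split c i χ)
        ≤⟨ *-monoʳ-≤ k (partitionCost-split E c i χ) ⟩
      k * (partitionCost E c + innerCost E c i χ)
        ≡⟨ *-distribˡ-+ k (partitionCost E c) _ ⟩
      k * partitionCost E c + k * innerCost E c i χ
        <⟨ +-mono-<-≤ cheap le ⟩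
      j * L + L
        ≡⟨ +-comm (j * L) L ⟩
      suc j * L
        ∎
      where open ≤-Reasoning
    rec : Closure E (split c i χ)
    rec = closure E bound steps (split c i χ) (trans (sym (+-suc j steps)) eq)
                  (split-surjective surj s) cheap′

  Light : Edges m → Subset m → Set
  Light E X = k * cutCost E (lookup X) < 2 * L

  record Pinned (E : Edges m) (c : Fin m → Fin j) (o : Fin m) (A : Subset m) : Set where
    field
      light : Light E A
      o∈    : lookup A o ≡ true
      mate  : ∃ λ u → c u ≡ c o × lookup A u ≡ false
  open Pinned

  -- A set between {o} and A splits the atom of o, so it cannot be cheap.
  kernel-heavy : ∀ {E : Edges m} {c : Fin m → Fin j} → Closed E c → ∀ {o} Y {A} → Pinned E c o A →
                 Y ⊆ˢ A → lookup Y o ≡ true → L ≤ k * cutCost E (lookup Y)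
  kernel-heavy {E = E} {c} closed {o} Y {A} pin Y⊆A o∈Y = begin
    L
      ≤⟨ <⇒≤ (closed (c o) Y (o , u , (refl , o∈Y) , (cu≡co , 𝔹.¬-not λ u∈Y →
           case trans (sym u∉A) (Y⊆A u u∈Y) of λ ()))) ⟩
    k * innerCost E c (c o) (lookup Y)
      ≤⟨ *-monoʳ-≤ k (innerCost≤cutCost E c (c o) (lookup Y)) ⟩
    k * cutCost E (lookup Y)
      ∎
    where
    open ≤-Reasoning
    u = proj₁ (mate pin)
    cu≡co = proj₁ (proj₂ (mate pin))
    u∉A = proj₂ (proj₂ (mate pin))

  -- Sunflowers of light sets are short

  module _ (E : Edges m) (bound : KBound E) where

    -- The `k - 1` petals and the remaining vertices, among them `o`, form a partition into `k`
    -- parts.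
    petals-cost : ∀ {Y As} → IsSunflower Y As → suc (length As) ≡ k → ∀ {o} → lookup Y o ≡ true →
                  L ≤ weigh As (cutCost E ∘ petal Y)
    petals-cost {Y} {As} (sunflower ps ap) eq {o} o∈Y = begin
      L
        ≤⟨ atLeast E bound (trans (cong suc (length-map (petal Y) As)) eq) (labels χs)
             (labels-surjective (AllPairs.map⁺ ap) (All.map⁺ (All.map proj₂ ps)) o
               (All.map⁺ (All.universal (λ A →
                 trans (cong (λ y → lookup A o ∧ not y) o∈Y) (𝔹.∧-zeroʳ _)) As))) ⟩
      partitionCost E (labels χs)
        ≤⟨ partitionCost-labels E χs ⟩
      weigh χs (cutCost E)
        ≡⟨ weigh-map (petal Y) As (cutCost E) ⟩
      weigh As (cutCost E ∘ petal Y)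
        ∎
      where
      open ≤-Reasoning
      χs = map (petal Y) As

    -- Two groups of `k - 1` petals give `P ≥ 2 L`, and the kernel gives `k y ≥ L`. By
    -- `sunflower-cost`, `k S ≥ k P + 2 κ k y ≥ 2 k L + 2 κ L = 4 (κ + 1) L`, whereas `2 (κ +
    -- 1)` light sets have `k S < 4 (κ + 1) L`.
    noSunflower : ∀ {κ} → 2 + κ ≡ k → ∀ {Y As} → IsSunflower Y As → length As ≡ suc κ + suc κ →
                  ∀ {o} → lookup Y o ≡ true → All (Light E) As → L ≤ k * cutCost E (lookup Y) → ⊥
    noSunflower {κ} refl {Y} {As} flower@(sunflower ps ap) len {o} o∈Y light heavy =
      <-irrefl refl (begin-strict
        (suc κ + suc κ) * (2 * L)
          ≡⟨ expand κ L ⟩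
        k * (L + L) + (κ + κ) * L
          ≤⟨ +-mono-≤ (*-monoʳ-≤ k halves) (*-monoʳ-≤ (κ + κ) heavy) ⟩
        k * P + (κ + κ) * (k * y)
          ≡⟨ collect κ P y ⟩
        k * (P + (κ + κ) * y)
          ≤⟨ *-monoʳ-≤ k {P + (κ + κ) * y} {S} (+-cancelʳ-≤ (2 * y) (P + (κ + κ) * y) S (begin
               P + (κ + κ) * y + 2 * y        ≡⟨ regroup κ P y ⟩
               P + (suc κ + suc κ) * y        ≡⟨ cong (λ r → P + r * y) (sym len) ⟩
               P + length As * y              ≤⟨ sunflower-cost E flower ⟩
               S + 2 * y                      ∎)) ⟩
        k * S
          <⟨ total ⟩
        (suc κ + suc κ) * (2 * L)
          ∎)
      where
      open ≤-Reasoning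
      P = weigh As (cutCost E ∘ petal Y)
      S = weigh As (cutCost E ∘ lookup)
      y = cutCost E (lookup Y)

      expand : ∀ κ L → (suc κ + suc κ) * (2 * L) ≡ (2 + κ) * (L + L) + (κ + κ) * L
      expand = solve-∀
      collect : ∀ κ P y → (2 + κ) * P + (κ + κ) * ((2 + κ) * y) ≡ (2 + κ) * (P + (κ + κ) * y)
      collect = solve-∀
      regroup : ∀ κ P y → P + (κ + κ) * y + 2 * y ≡ P + (suc κ + suc κ) * y
      regroup = solve-∀

      front = List.take (suc κ) As
      back  = List.drop (suc κ) As

      halves : L + L ≤ P
      halves = begin
        L + L
          ≤⟨ +-mono-≤
               (petals-cost {Y} {front} (sunflower (All.take⁺ (suc κ) ps) (AllPairs.take⁺ (suc κ) ap))
                 (cong suc (trans (length-take (suc κ) As)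
                   (m≤n⇒m⊓n≡m (≤-trans (m≤m+n (suc κ) (suc κ)) (≤-reflexive (sym len)))))) o∈Y)
               (petals-cost {Y} {back} (sunflower (All.drop⁺ (suc κ) ps) (AllPairs.drop⁺ (suc κ) ap))
                 (cong suc (trans (length-drop (suc κ) As)
                   (trans (cong (_∸ suc κ) len) (m+n∸m≡n (suc κ) (suc κ))))) o∈Y) ⟩
        weigh front (cutCost E ∘ petal Y) + weigh back (cutCost E ∘ petal Y)
          ≡⟨ sym (weigh-++ front back _) ⟩
        weigh (front ++ back) (cutCost E ∘ petal Y)
          ≡⟨ cong (λ As → weigh As (cutCost E ∘ petal Y)) (take++drop≡id (suc κ) As) ⟩
        P
          ∎

      -- Each light set leaves a slack of 1 and there is at least one set, so the strict inequality
      -- survives summation.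
      total : k * S < (suc κ + suc κ) * (2 * L)
      total = begin-strict
        k * S
          ≡⟨ sym (weigh-* As k _) ⟩
        weigh As (λ A → k * cutCost E (lookup A))
          <⟨ +-monoˡ-≤ _ (≤-trans (s≤s z≤n) (≤-reflexive (sym (trans (weigh-const As 1)
               (trans (*-identityʳ (length As)) len))))) ⟩
        weigh As (λ _ → 1) + weigh As (λ A → k * cutCost E (lookup A))
          ≡⟨ sym (weigh-+ As _ _) ⟩
        weigh As (λ A → suc (k * cutCost E (lookup A)))
          ≤⟨ weigh-monoᴬ light ⟩
        weigh As (λ _ → 2 * L)
          ≡⟨ weigh-const As (2 * L) ⟩
        length As * (2 * L)
          ≡⟨ cong (_* (2 * L)) len ⟩
        (suc κ + suc κ) * (2 * L)
          ∎

  -- Light sets in contracted graphs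

  module _ (E : Edges m) {g : Fin m → A} (q : Quotient g) where
    open Quotient q

    contract : Edges size
    contract = map (λ (u , v) → class u , class v) E

    -- Partitions of the contracted graph pull back along `class` at the same cost.
    contract-KBound : KBound E → KBound contract
    contract-KBound bound c surj = subst (L ≤_) (sym (weigh-map _ E _)) (bound (c ∘ class) λ i →
      let x , cx≡i = surj i in rep x , trans (cong c (class-rep x)) cx≡i)

    Saturated : Subset m → Set
    Saturated A = ∀ u v → g u ≡ g v → lookup A u ≡ lookup A v

    -- A saturated set is recovered from its contraction by pulling back along `class`, so
    -- contracting does not raise its cost.
    contract-Light : ∀ {A} → Light E A × Saturated A → Light contract (preimage rep A)
    contract-Light {A} (light , sat) = ≤-<-trans (*-monoʳ-≤ k (begin
      cutCost contract (lookup (preimage rep A))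
        ≡⟨ weigh-map _ E _ ⟩
      cutCost E (lookup (preimage rep A) ∘ class)
        ≤⟨ cost-mono 𝔹._≟_ 𝔹._≟_ E (λ u v eq → trans (same u) (trans eq (sym (same v)))) ⟩
      cutCost E (lookup A)
        ∎)) light
      where
      open ≤-Reasoning
      same : ∀ v → lookup (preimage rep A) (class v) ≡ lookup A v
      same v = trans (V.lookup∘tabulate _ (class v)) (sat _ _ (rep-class v))

    preimage-rep-injective : ∀ {A B} → Saturated A → Saturated B →
                             preimage rep A ≡ preimage rep B → A ≡ B
    preimage-rep-injective {A} {B} satA satB eq = lookup-ext λ v → begin
      lookup A v                         ≡⟨ satA _ _ (sym (rep-class v)) ⟩
      lookup A (rep (class v))           ≡⟨ sym (V.lookup∘tabulate _ (class v)) ⟩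
      lookup (preimage rep A) (class v)  ≡⟨ cong (λ X → lookup X (class v)) eq ⟩
      lookup (preimage rep B) (class v)  ≡⟨ V.lookup∘tabulate _ (class v) ⟩
      lookup B (rep (class v))           ≡⟨ satB _ _ (rep-class v) ⟩
      lookup B v                         ∎
      where open ≡-Reasoning

  one-atom : ∀ {E : Edges m} {c : Fin m → Fin j} → Closed E c → ∀ {A} → Light E A → ∀ {i i′} →
             i ≢ i′ → Splits c i (lookup A) → Splits c i′ (lookup A) → ⊥
  one-atom {E = E} {c} closed {A} light {i} {i′} i≢i′ s s′ = <-irrefl refl (begin-strict
    2 * L
      ≡⟨ cong (L +_) (+-identityʳ L) ⟩
    L + L
      <⟨ +-mono-< (closed i A s) (closed i′ A s′) ⟩
    k * innerCost E c i (lookup A) + k * innerCost E c i′ (lookup A)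
      ≡⟨ sym (*-distribˡ-+ k (innerCost E c i (lookup A)) _) ⟩
    k * (innerCost E c i (lookup A) + innerCost E c i′ (lookup A))
      ≤⟨ *-monoʳ-≤ k (innerCost-+ E c (lookup A) i≢i′) ⟩
    k * cutCost E (lookup A)
      <⟨ light ⟩
    2 * L
      ∎)
    where open ≤-Reasoning

  -- Counting light sets

  module _ {κ} (k≡ : 2 + κ ≡ k) where

    -- r petals are impossible, and β is the resulting bound on the sets pinned at one vertex.
    r β D : ℕ
    r = suc κ + suc κ
    β = suc (r * k) ^ k
    -- The bound of `thin-bound` at `m = k`.
    D = (2 ^ k + k) * β + (2 ^ k + k) * β

    module _ {m} (E : Edges m) (bound : KBound E) where

      -- The sunflower lemma, by induction on the number `d` of points outside the kernel `Y`. Since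
      -- `r` petals are impossible, every set is `Y` itself or contains one of at most `r * s`
      -- points outside `Y`; that point joins the kernel. The fixed `s` keeps the base of the power
      -- constant while `d` drops.
      pinned-bound : ∀ {c : Fin m → Fin j} → Closed E c → ∀ {o s} d Y → d ≤ s → lookup Y o ≡ true →
        ∀ {xs} → Unique xs → All (λ A → Pinned E c o A × Y ⊆ˢ A × card (petal Y A) ≤ d) xs →
        length xs ≤ suc (r * s) ^ d
      pinned-bound closed zero Y _ _ xs! Qxs = unique-constant xs! (All.map (λ {A} (_ , Y⊆A , small) →
        no-petal {Y = Y} {A} Y⊆A λ v Av → case small-empty A small v Av of λ ()) Qxs)
        where
        small-empty : ∀ A → card (petal Y A) ≤ 0 → ∀ v → petal Y A v ≡ true → Fin 0
        small-empty A small v Av = subst Fin (n≤0⇒n≡0 small) (proj₁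
          (enum-surjective (tabulate (petal Y A)) v (trans (V.lookup∘tabulate _ v) Av)))
      pinned-bound {c = c} closed {o} {s} (suc d) Y d<s o∈Y {xs} xs! Qxs
        with findSunflower Y {λ A → Pinned E c o A × Y ⊆ˢ A × card (petal Y A) ≤ suc d}
               (proj₁ ∘ proj₂) (proj₂ ∘ proj₂) r Qxs
      ... | inj₁ (A ∷ As , flower , len , QAs@((pin , Y⊆A , _) ∷ _)) =
        ⊥-elim (noSunflower E bound k≡ flower len o∈Y (All.map (light ∘ proj₁) QAs)
          (kernel-heavy closed Y pin Y⊆A o∈Y))
      ... | inj₂ (U , len , hit) = begin
        length xs
          ≤⟨ cover P? bounded (nothing ∷ map just U) xs! Qxs (All.map index hit) ⟩
        suc (length (map just U)) * suc (r * s) ^ d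
          ≤⟨ *-monoˡ-≤ _ (s≤s (≤-trans (≤-reflexive (length-map just U))
               (≤-trans len (*-monoʳ-≤ r d<s)))) ⟩
        suc (r * s) ^ suc d
          ∎
        where
        open ≤-Reasoning
        Q : Subset m → Set
        Q A = Pinned E c o A × Y ⊆ˢ A × card (petal Y A) ≤ suc d
        P : Maybe (Fin m) → Subset m → Set
        P nothing  A = A ≡ Y
        P (just u) A = petal Y A u ≡ true
        P? : ∀ i A → Dec (P i A)
        P? nothing  A = V.≡-dec 𝔹._≟_ A Y
        P? (just u) A = petal Y A u 𝔹.≟ true
        index : ∀ {A} → A ≡ Y ⊎ Any (λ u → petal Y A u ≡ true) U →
                Any (λ i → P i A) (nothing ∷ map just U)
        index (inj₁ eq) = here eq
        index (inj₂ p)  = there (Any.map⁺ p)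
        bounded : ∀ i {ys} → Unique ys → All Q ys → All (P i) ys → length ys ≤ suc (r * s) ^ d
        bounded nothing  ys! Qys Pys = ≤-trans (unique-constant ys! Pys) (m^n>0 (suc (r * s)) d)
        bounded (just u) ys! Qys Pys = pinned-bound closed d (Y [ u ]≔ true) (<⇒≤ d<s)
          (⊆-insert Y u o o∈Y) ys! (All.zipWith (λ {A} ((pin , Y⊆A , small) , Au) →
            pin , insert-⊆ Y A Y⊆A (proj₁ (petal-∈ Y A Au)) ,
            s≤s⁻¹ (≤-trans (petal-insert-< Y A Au) small))
            (Qys , Pys))

      small-bound : ∀ {xs} → Unique xs → All (λ A → Light E A × ∣ A ∣ ≤ k) xs →
                    length xs ≤ (2 ^ k + m) * β
      small-bound {[]}     _   _ = z≤n
      small-bound {A ∷ xs} xs! Qxs@((light , _) ∷ _) with F.any? {m} (λ _ → yes tt)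
      -- The partition into one part needs a vertex; without vertices there is only one subset.
      ... | no empty = ≤-trans
        (unique-constant {x = A} xs!
          (All.universal (λ B → lookup-ext λ v → contradiction (v , tt) empty) (A ∷ xs)))
        (*-mono-≤ (≤-trans (m^n>0 2 k) (m≤m+n (2 ^ k) m)) (m^n>0 (suc (r * k)) k))
      ... | yes (o , _) = begin
        length (A ∷ xs)
          ≤⟨ cover P? bounded is xs! Qxs (All.universal index (A ∷ xs)) ⟩
        length is * β
          ≤⟨ *-monoˡ-≤ β len ⟩
        (2 ^ k + m) * β
          ∎
        where
        open ≤-Reasoning
        -- The existence of a light set forces `L` to be positive, which is the strict inequality
        -- `closure` needs for the one-part partition of cost 0.
        0<L : 0 < L
        0<L = n≢0⇒n>0 λ { refl → case ≤-trans light (≤-reflexive (*-zeroʳ 2)) of λ () }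

        onto : StrictlySurjective _≡_ (λ (_ : Fin m) → zero {0})
        onto zero = o , refl

        closed-partition : Closure E (λ _ → zero {0})
        closed-partition = closure E bound (suc κ) (λ _ → zero) k≡ onto
          (subst₂ _<_ (sym (trans (cong (k *_) (weigh-0 E)) (*-zeroʳ k))) (sym (*-identityˡ L)) 0<L)

        open Closure closed-partition

        is : List (Subset size ⊎ Fin m)
        is = map inj₁ (subsets size) ++ map inj₂ (List.allFin m)

        len : length is ≤ 2 ^ k + m
        len = begin
          length is
            ≡⟨ length-++ (map inj₁ (subsets size)) ⟩
          length (map inj₁ (subsets size)) + length (map inj₂ (List.allFin m))
            ≡⟨ cong₂ _+_ (trans (length-map inj₁ (subsets size)) (length-subsets size))
                         (trans (length-map inj₂ (List.allFin m)) (length-tabulate id)) ⟩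
          2 ^ size + m
            ≤⟨ +-monoˡ-≤ m (^-monoʳ-≤ 2 (<⇒≤ size<k)) ⟩
          2 ^ k + m
            ∎

        P : Subset size ⊎ Fin m → Subset m → Set
        P (inj₁ X) A = A ≡ preimage atom X
        P (inj₂ o) A = ∃ λ u → (atom u ≡ atom o × lookup A o ≡ true) × lookup A u ≡ false
        P? : ∀ i A → Dec (P i A)
        P? (inj₁ X) A = V.≡-dec 𝔹._≟_ A (preimage atom X)
        P? (inj₂ o) A = F.any? λ u →
          (atom u F.≟ atom o ×-dec lookup A o 𝔹.≟ true) ×-dec lookup A u 𝔹.≟ false

        index : ∀ A → Any (λ i → P i A) is
        index A with F.any? (λ o → P? (inj₂ o) A)
        ... | yes (o , p) = Any.++⁺ʳ _ (lose (∈-map⁺ inj₂ (∈-allFin o)) p)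
        ... | no none     =
          let X , eq = preimage-surjective surjective A λ u v atom≡ u∈A →
                𝔹.¬-not λ v∉A → none (u , v , (sym atom≡ , u∈A) , v∉A)
          in Any.++⁺ˡ (lose (∈-map⁺ inj₁ (∈-subsets X)) eq)

        bounded : ∀ i {ys} → Unique ys → All (λ A → Light E A × ∣ A ∣ ≤ k) ys → All (P i) ys →
                  length ys ≤ β
        bounded (inj₁ X) ys! _   Pys = ≤-trans (unique-constant ys! Pys) (m^n>0 (suc (r * k)) k)
        bounded (inj₂ o) ys! Qys Pys = pinned-bound closed k Y ≤-refl (V.lookup∘update o none true) ys!
          (All.zipWith (λ {A} ((light , small) , (u , (atom≡ , o∈A) , u∉A)) →
             record { light = light ; o∈ = o∈A ; mate = u , atom≡ , u∉A } ,
             insert-⊆ none A (λ v v∈ → case trans (sym (V.lookup-replicate v false)) v∈ of λ ()) o∈A ,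
             ≤-trans (card-petal Y A) small)
           (Qys , Pys))
          where
          none = replicate m false
          -- All these sets contain `o`, so the kernel starts as the singleton of `o`, within the
          -- atom that they split.
          Y = none [ o ]≔ true

      light-∁ : ∀ {A} → Light E A → Light E (∁ A)
      light-∁ {A} = ≤-<-trans (*-monoʳ-≤ k (cost-mono 𝔹._≟_ 𝔹._≟_ E λ u v eq →
        trans (V.lookup-map u not A) (trans (cong not eq) (sym (V.lookup-map v not A)))))

      -- Sets with more than `k` elements are replaced by their complements, which are light too;
      -- hence the doubling.
      thin-bound : ∀ {xs} → Unique xs → All (λ A → Light E A × (∣ A ∣ ≤ k ⊎ ∣ ∁ A ∣ ≤ k)) xs →
                   length xs ≤ (2 ^ k + m) * β + (2 ^ k + m) * β
      thin-bound {xs} xs! Qxs = begin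
        length xs
          ≡⟨ sym (length-filter-+ small? xs) ⟩
        length (filter small? xs) + length large
          ≡⟨ cong (length (filter small? xs) +_) (sym (length-map ∁ large)) ⟩
        length (filter small? xs) + length (map ∁ large)
          ≤⟨ +-mono-≤
               (small-bound (Unique.filter⁺ small? xs!)
                 (All.zipWith (λ ((light , _) , small) → light , small)
                   (All.filter⁺ small? Qxs , All.all-filter small? xs)))
               (small-bound (Unique.map⁺ ∁-injective (Unique.filter⁺ (¬? ∘ small?) xs!))
                 (All.map⁺ (All.zipWith
                   (λ { {A} ((light , inj₁ small) , big) → contradiction small big
                      ; {A} ((light , inj₂ small) , big) → light-∁ {A} light , small })
                   (All.filter⁺ (¬? ∘ small?) Qxs , All.all-filter (¬? ∘ small?) xs)))) ⟩
        (2 ^ k + m) * β + (2 ^ k + m) * β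
          ∎
        where
        open ≤-Reasoning
        small? : ∀ A → Dec (∣ A ∣ ≤ k)
        small? A = ∣ A ∣ ≤? k
        large = filter (¬? ∘ small?) xs
        ∁-injective : ∀ {A B : Subset m} → ∁ A ≡ ∁ B → A ≡ B
        ∁-injective {A} {B} eq = lookup-ext λ v → 𝔹.not-injective
          (trans (sym (V.lookup-map v not A))
            (trans (cong (λ X → lookup X v) eq) (V.lookup-map v not B)))

    -- In the induction two contracted graphs each contribute a constant term `D`; one of them is
    -- absorbed by the extra 1 in `∸-superadditive`.
    LightBound : ℕ → Set
    LightBound m = ∀ (E : Edges m) → KBound E → ∀ {xs} → Unique xs → All (Light E) xs →
                   length xs ≤ D + D * (m ∸ k)

    fat-bound : ∀ {m} → (∀ {m′} → m′ < m → LightBound m′) → ∀ (E : Edges m) → KBound E →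
                ∀ {X} → Light E X → k < ∣ X ∣ → k < ∣ ∁ X ∣ →
                ∀ {xs} → Unique xs → All (Light E) xs → length xs ≤ D + D * (m ∸ k)
    fat-bound {m} ih E bound {X} lightX k<∣X∣ k<∣∁X∣ {xs} xs! light = begin
      length xs
        ≡⟨ sym (length-filter-+ cut? xs) ⟩
      length (filter cut? xs) + length (filter (¬? ∘ cut?) xs)
        ≡⟨ +-comm (length (filter cut? xs)) _ ⟩
      length (filter (¬? ∘ cut?) xs) + length (filter cut? xs)
        ≤⟨ +-mono-≤
             (side true (Unique.filter⁺ (¬? ∘ cut?) xs!) (All.zip
               (All.filter⁺ (¬? ∘ cut?) light , All.all-filter (¬? ∘ cut?) xs)))
             (side false (Unique.filter⁺ cut? xs!) (All.zipWith
               (λ {A} (l , cut) → l , uncut {A} l cut)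
               (All.filter⁺ cut? light , All.all-filter cut? xs))) ⟩
      D + D * (size′ true ∸ k) + (D + D * (size′ false ∸ k))
        ≡⟨ regroup D (size′ true ∸ k) (size′ false ∸ k) ⟩
      D + D * suc (size′ true ∸ k + (size′ false ∸ k))
        ≤⟨ +-monoʳ-≤ D (*-monoʳ-≤ D (∸-superadditive (shrinks true) (shrinks false)
             (keep-size-+ X atom refines′) size<k (<-≤-trans k<∣X∣ (∣p∣≤n X)))) ⟩
      D + D * (m ∸ k)
        ∎
      where
      open ≤-Reasoning
      regroup : ∀ d x y → d + d * x + (d + d * y) ≡ d + d * suc (x + y)
      regroup = solve-∀

      side₂ : Bool → Fin 2
      side₂ true  = zero
      side₂ false = suc zero

      inhabited : ∀ Y → k < ∣ Y ∣ → ∃ λ v → lookup Y v ≡ true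
      inhabited Y k<∣Y∣ = let i = Fin.fromℕ< (≤-<-trans z≤n k<∣Y∣) in enum Y i , enum-∈ Y i

      outside : ∀ {v} → lookup (∁ X) v ≡ true → lookup X v ≡ false
      outside {v} eq = 𝔹.not-injective (trans (sym (V.lookup-map v not X)) eq)

      surj₂ : StrictlySurjective _≡_ (side₂ ∘ lookup X)
      surj₂ zero       = let v , v∈ = inhabited X k<∣X∣ in v , cong side₂ v∈
      surj₂ (suc zero) = let v , v∉ = inhabited (∁ X) k<∣∁X∣ in v , cong side₂ (outside v∉)

      -- For the two sides of `X` the cost hypothesis of `closure` is the lightness of `X`.
      closed-partition : Closure E (side₂ ∘ lookup X)
      closed-partition = closure E bound κ (side₂ ∘ lookup X) k≡ surj₂
        (≤-<-trans (*-monoʳ-≤ k (cost-mono F._≟_ 𝔹._≟_ E {d = lookup X} λ u v → cong side₂)) lightX)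

      open Closure closed-partition

      refines′ : ∀ u v → atom u ≡ atom v → lookup X u ≡ lookup X v
      refines′ u v eq with lookup X u | lookup X v | refines u v eq
      ... | true  | true  | _ = refl
      ... | false | false | _ = refl

      -- A set splitting no atom outside `X` survives in `keep true`. By `one-atom`, a set that does
      -- split one splits none inside `X` and survives in `keep false`.
      cut? : ∀ A → Dec (Cuts X atom refines′ true A)
      cut? = cuts? X atom refines′ true

      size′ : Bool → ℕ
      size′ b = Quotient.size (keep X atom refines′ b)

      -- The contracted side has more than `k` vertices but there are fewer than `k` atoms, so two
      -- of its vertices are merged.
      shrinks : ∀ b → size′ b < m
      shrinks true  =
        let u , v , u≢v , u∉ , v∉ , eq = collision atom (∁ X) (<-trans size<k k<∣∁X∣) in
        keep-size-< X atom refines′ true u≢v (outside u∉) (outside v∉) eq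
      shrinks false =
        let u , v , u≢v , u∈ , v∈ , eq = collision atom X (<-trans size<k k<∣X∣) in
        keep-size-< X atom refines′ false u≢v u∈ v∈ eq

      uncut : ∀ {A} → Light E A → Cuts X atom refines′ true A → ¬ Cuts X atom refines′ false A
      uncut {A} l (u , v , (u∉X , uv) , u∈A , v∉A) (u′ , v′ , (u′∈X , uv′) , u′∈A , v′∉A) =
        one-atom {E = E} closed {A} l
          (λ eq → case trans (sym u∉X) (trans (refines′ u u′ eq) u′∈X) of λ ())
          (u , v , (refl , u∈A) , (sym uv , v∉A)) (u′ , v′ , (refl , u′∈A) , (sym uv′ , v′∉A))

      side : ∀ b {ys} → Unique ys → All (λ A → Light E A × ¬ Cuts X atom refines′ b A) ys →
             length ys ≤ D + D * (size′ b ∸ k)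
      side b {ys} ys! Qys = begin
        length ys
          ≡⟨ sym (length-map (preimage (Quotient.rep q)) ys) ⟩
        length (map (preimage (Quotient.rep q)) ys)
          ≤⟨ ih (shrinks b) (contract E q) (contract-KBound E q bound)
               (unique-map (λ {A} {B} (_ , satA) (_ , satB) →
                 preimage-rep-injective E q {A} {B} satA satB) Sys ys!)
               (All.map⁺ (All.map (λ {A} → contract-Light E q {A}) Sys)) ⟩
        D + D * (size′ b ∸ k)
          ∎
        where
        q = keep X atom refines′ b
        Sys : All (λ A → Light E A × Saturated E q A) ys
        Sys = All.map (λ {A} (l , ¬cut) → l , uncut-saturated X atom refines′ b {A} ¬cut) Qys

    light-bound : ∀ {m} → Acc _<_ m → LightBound m
    light-bound {m} (acc rec) E bound {xs} xs! light
      with Any.any? (λ A → k <? ∣ A ∣ ×-dec k <? ∣ ∁ A ∣) xs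
    ... | yes fat = let lightX , k<∣X∣ , k<∣∁X∣ = All.lookupAny light fat in
      fat-bound (λ lt → light-bound (rec lt)) E bound {Any.lookup fat} lightX k<∣X∣ k<∣∁X∣ xs! light
    ... | no thin = begin
      length xs
        ≤⟨ thin-bound E bound xs! (All.zipWith id (light , All.tabulate thin′)) ⟩
      (2 ^ k + m) * β + (2 ^ k + m) * β
        ≡⟨ sym (*-distribˡ-+ (2 ^ k + m) β β) ⟩
      (2 ^ k + m) * (β + β)
        ≤⟨ *-monoˡ-≤ (β + β) (begin
             2 ^ k + m                               ≤⟨ +-monoʳ-≤ (2 ^ k) (m≤n+m∸n m k) ⟩
             2 ^ k + (k + (m ∸ k))                   ≡⟨ sym (+-assoc (2 ^ k) k (m ∸ k)) ⟩
             2 ^ k + k + (m ∸ k)                     ≤⟨ +-monoʳ-≤ (2 ^ k + k) (m≤n*m (m ∸ k) (2 ^ k + k)) ⟩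
             2 ^ k + k + (2 ^ k + k) * (m ∸ k)       ∎) ⟩
      (2 ^ k + k + (2 ^ k + k) * (m ∸ k)) * (β + β)
        ≡⟨ regroup (2 ^ k + k) (m ∸ k) β ⟩
      D + D * (m ∸ k)
        ∎
      where
      open ≤-Reasoning
      instance _ = >-nonZero (≤-trans (m^n>0 2 k) (m≤m+n (2 ^ k) k))
      regroup : ∀ x y b → (x + x * y) * (b + b) ≡ x * b + x * b + (x * b + x * b) * y
      regroup = solve-∀
      thin′ : ∀ {A} → A ∈ xs → ∣ A ∣ ≤ k ⊎ ∣ ∁ A ∣ ≤ k
      thin′ {A} A∈xs with ∣ A ∣ ≤? k | ∣ ∁ A ∣ ≤? k
      ... | yes p | _     = inj₁ p
      ... | no _  | yes q = inj₂ q
      ... | no ¬p | no ¬q = contradiction (lose A∈xs (≰⇒> ¬p , ≰⇒> ¬q)) thin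

    -- The exponent is made up of `3 * k` from `suc (r * k) ≤ k ^ 3` inside `β`, `k` from
    -- `2 ^ k + k ≤ 2 * k ^ k`, and at most `k` from the factor `4 ≤ k ^ 2`.
    D-bound : D ≤ k ^ (5 * k)
    D-bound = begin
      (2 ^ k + k) * β + (2 ^ k + k) * β
        ≤⟨ +-mono-≤ half half ⟩
      (k ^ k + k ^ k) * k ^ (3 * k) + (k ^ k + k ^ k) * k ^ (3 * k)
        ≡⟨ regroup (k ^ k) (k ^ (3 * k)) ⟩
      2 ^ 2 * (k ^ k * k ^ (3 * k))
        ≤⟨ *-monoˡ-≤ _ (^-monoˡ-≤ 2 2≤k) ⟩
      k ^ 2 * (k ^ k * k ^ (3 * k))
        ≡⟨ cong (k ^ 2 *_) (sym (^-distribˡ-+-* k k (3 * k))) ⟩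
      k ^ 2 * k ^ (4 * k)
        ≡⟨ sym (^-distribˡ-+-* k 2 (4 * k)) ⟩
      k ^ (2 + 4 * k)
        ≤⟨ ^-monoʳ-≤ k (+-monoˡ-≤ (4 * k) 2≤k) ⟩
      k ^ (5 * k)
        ∎
      where
      open ≤-Reasoning
      2≤k : 2 ≤ k
      2≤k = subst (2 ≤_) k≡ (m≤m+n 2 κ)
      instance _ = >-nonZero (<⇒≤ 2≤k)
      regroup : ∀ x y → (x + x) * y + (x + x) * y ≡ 4 * (x * y)
      regroup = solve-∀
      base : ∀ κ → suc ((suc κ + suc κ) * (2 + κ)) ≤ (2 + κ) ^ 3
      -- The added polynomial is the difference of the two sides.
      base κ = ≤-trans (m≤m+n _ (κ * κ * κ + 4 * (κ * κ) + 6 * κ + 3)) (≤-reflexive (cube κ))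
        where
        cube : ∀ κ → suc ((suc κ + suc κ) * (2 + κ)) + (κ * κ * κ + 4 * (κ * κ) + 6 * κ + 3) ≡
               (2 + κ) * ((2 + κ) * ((2 + κ) * 1))
        cube = solve-∀
      half : (2 ^ k + k) * β ≤ (k ^ k + k ^ k) * k ^ (3 * k)
      half = *-mono-≤
        (+-mono-≤ (^-monoˡ-≤ k 2≤k)
          (≤-trans (≤-reflexive (sym (^-identityʳ k))) (^-monoʳ-≤ k (<⇒≤ 2≤k))))
        (≤-trans (^-monoˡ-≤ k (subst (λ k → suc (r * k) ≤ k ^ 3) k≡ (base κ)))
          (≤-reflexive (^-*-assoc k 3 k)))

-- From medium cuts of a multigraph to light sets

length-filter-¬ : ∀ {P : A → Set} (P? : ∀ x → Dec (P x)) xs →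
                  length (filter (¬? ∘ P?) xs) ≡ weigh xs (λ x → if does (P? x) then 0 else 1)
length-filter-¬ P? []       = refl
length-filter-¬ P? (x ∷ xs) with does (P? x)
... | true  = length-filter-¬ P? xs
... | false = cong suc (length-filter-¬ P? xs)

-- `_/_` reduces to lowest terms and so hides numerator and denominator; for unnormalised rationals
-- the inequality is a cross multiplication.
clear-denominator : ∀ w l k .{{_ : NonZero k}} →
                    ℤ.+ w / 1 ℚ.< (ℤ.+ 2 / 1) ℚ.* (ℤ.+ l / k) → k * w < 2 * l
clear-denominator w l k@(suc k-1) lt = subst₂ _<_
  (trans (*-comm w (1 * k)) (cong (_* w) (*-identityˡ k))) (*-identityʳ (2 * l))
  (ℤ.drop‿+<+ (subst₂ ℤ._<_
    (sym (ℤ.pos-* w (1 * k)))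
    (trans (cong (ℤ._* ℤ.+ 1) (sym (ℤ.pos-* 2 l))) (sym (ℤ.pos-* (2 * l) 1)))
    (ℚᵘ.drop-*<* (ℚᵘ.<-respˡ-≃ (ℚ.toℚᵘ-fromℚᵘ (mkℚᵘ (ℤ.+ w) 0))
      (ℚᵘ.<-respʳ-≃ rhs (ℚ.toℚᵘ-mono-< lt))))))
  where
  rhs : ℚ.toℚᵘ ((ℤ.+ 2 / 1) ℚ.* (ℤ.+ l / k)) ≃ mkℚᵘ (ℤ.+ 2) 0 ℚᵘ.* mkℚᵘ (ℤ.+ l) k-1
  rhs = ℚᵘ.≃-trans (ℚ.toℚᵘ-homo-* (ℤ.+ 2 / 1) (ℤ.+ l / k))
    (ℚᵘ.*-cong (ℚ.toℚᵘ-fromℚᵘ (mkℚᵘ (ℤ.+ 2) 0)) (ℚ.toℚᵘ-fromℚᵘ (mkℚᵘ (ℤ.+ l) k-1)))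

side : Cut n → Subset n
side C = tabulate λ v → does (part C v F.≟ zero)

same-side : ∀ (C : Cut n) u v → part C u ≡ part C v ⇔ lookup (side C) u ≡ lookup (side C) v
same-side C u v = mk⇔
  (λ eq → trans (at u) (trans (cong (λ i → does (i F.≟ zero)) eq) (sym (at v))))
  (λ eq → two (part C u) (part C v) (trans (sym (at u)) (trans eq (at v))))
  where
  at : ∀ v → lookup (side C) v ≡ does (part C v F.≟ zero)
  at = V.lookup∘tabulate _
  two : ∀ (i i′ : Fin 2) → does (i F.≟ zero) ≡ does (i′ F.≟ zero) → i ≡ i′
  two zero       zero       _ = refl
  two (suc zero) (suc zero) _ = refl

-- Equivalent cuts may have complementary sides, but counting only needs this direction:
-- inequivalent cuts have different sides.
side-≈ : ∀ {C C′ : Cut n} → side C ≡ side C′ → C ≈ C′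
side-≈ {C = C} {C′} eq u v = E.trans (same-side C u v)
  (E.trans (subst (λ X → lookup (side C) u ≡ lookup (side C) v ⇔ lookup X u ≡ lookup X v) eq E.refl)
           (E.sym (same-side C′ u v)))
  where module E = IsEquivalence (⇔-isEquivalence {0ℓ})

theorem9 : Σ[ C ∈ ℕ ] 0 < C ×
    (∀ (k : ℕ) (3≤k : 3 ≤ k) (n : ℕ) (k≤n : k ≤ n) (G : Multigraph n) →
    AtMost (KCut-setoid n 2) (k ^ (C * k) * n) (Medium G k 3≤k k≤n))
theorem9 = 5 , s≤s z≤n , bound
  where
  bound : ∀ (k : ℕ) (3≤k : 3 ≤ k) (n : ℕ) (k≤n : k ≤ n) (G : Multigraph n) →
          AtMost (KCut-setoid n 2) (k ^ (5 * k) * n) (Medium G k 3≤k k≤n)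
  bound (suc zero)      (s≤s ())
  bound k@(suc (suc κ)) 3≤k n k≤n G xs xs! medium = begin
    length xs
      ≡⟨ sym (length-map side xs) ⟩
    length (map side xs)
      ≤⟨ light-bound k L {κ} refl (<-wellFounded n) (edges G) kbound
           (AllPairs.map⁺ (AllPairs.map (λ {C} {C′} C≉ eq → C≉ (side-≈ {C = C} {C′} eq)) xs!))
           (All.map⁺ (All.map (λ {C} → light {C}) medium)) ⟩
    d + d * (n ∸ k)
      ≡⟨ sym (*-suc d (n ∸ k)) ⟩
    d * suc (n ∸ k)
      -- As `k ≥ 1`, `suc (n ∸ k)` is at most `suc (n ∸ 1)`, which is `n`.
      ≤⟨ *-mono-≤ (D-bound k L {κ} refl) (s≤s (∸-monoʳ-≤ n (s≤s z≤n))) ⟩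
    k ^ (5 * k) * suc (n ∸ 1)
      ≡⟨ cong (k ^ (5 * k) *_) (m+[n∸m]≡n (≤-trans (s≤s z≤n) k≤n)) ⟩
    k ^ (5 * k) * n
      ∎
    where
    open ≤-Reasoning
    L = λₖ G k 3≤k k≤n
    d = D k L {κ} refl

    kbound : KBound k L (edges G)
    kbound c surj = ≤-trans (proj₂ (proj₂ (minWeight G k k≤n)) (mk↠ₛ {to = c} surj))
      (≤-reflexive (length-filter-¬ (λ e → c (proj₁ e) F.≟ c (proj₂ e)) (edges G)))

    light : ∀ {C} → Medium G k 3≤k k≤n C → Light k L (edges G) (side C)
    light {C} (_ , lt) = ≤-<-trans
      (*-monoʳ-≤ k (≤-trans
        (cost-mono 𝔹._≟_ F._≟_ (edges G) λ u v → Equivalence.to (same-side C u v))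
        (≤-reflexive (sym (length-filter-¬ (λ e → part C (proj₁ e) F.≟ part C (proj₂ e)) (edges G))))))
      (clear-denominator (length (∂ G C)) L k lt)
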